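{- For every $\epsilon>0$ there is $q_0(\epsilon)$ such that for every odd prime power $q\geqslant q_0(\epsilon)$ and every subset $Y\subseteq \mathbb{F}_q$ with $|Y|\leqslant (\tfrac12-\epsilon)\log_2 q$, the set $\mathcal{S}_q$ shatters $Y$. Equivalently, $\liminf_{q\to\infty} \frac{m_q}{\log_2 q}\geqslant \frac12$, where $m_q$ is the largest integer such that every subset $Y\subseteq\mathbb{F}_q$ with $|Y|\leqslant m_q$ is shattered by $\mathcal{S}_q$.
   Context: Let $q$ be an odd prime power and $\mathcal{S}_q=\{x^2 : x\in\mathbb{F}_q^\times\}$ the set of nonzero squares in $\mathbb{F}_q$. For $x\in\mathbb{F}_q$ write $\mathcal{S}_q+x=\{z+x: z\in\mathcal{S}_q\}$. A set $Y=\{y_1,\dots,y_n\}\subseteq\mathbb{F}_q$ (with $n$ distinct elements) is shattered by $\mathcal{S}_q$ if for every subset $A\subseteq Y$ (including $\emptyset$ and $Y$) there exists $x\in\mathbb{F}_q$ with $x\notin Y$ such that for all $j$, $y_j\in A$ if and only if $y_j\in \mathcal{S}_q+x$. The limit inferior is taken over odd prime powers $q\to\infty$. -}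

module Defs where

open import Data.Nat using (ℕ; suc)
open import Data.Nat.Primality using (Prime)
open import Data.Fin using (Fin)
open import Data.Vec using (Vec; lookup)
open import Data.Bool using (Bool; true)
open import Data.Product using (∃-syntax; _×_)
open import Relation.Binary.PropositionalEquality using (_≡_; _≢_)
open import Algebra.Structures using (IsCommutativeRing)
open import Function.Bundles using (_⇔_)

-- A field structure on the q-element set Fin q (every finite field of
-- order q is isomorphic to one of these; F_q is unique up to isomorphism).
record FieldOn (q : ℕ) : Set where
  infixl 6 _+_
  infixl 7 _*_
  field
    _+_ _*_  : Fin q → Fin q → Fin q
    -_       : Fin q → Fin q
    0# 1#    : Fin q
    isCommutativeRing : IsCommutativeRing _≡_ _+_ _*_ -_ 0# 1#
    0≢1      : 0# ≢ 1#
    inverse  : ∀ x → x ≢ 0# → ∃[ y ] (x * y ≡ 1#)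

OddPrimePower : ℕ → Set
OddPrimePower q = ∃[ p ] ∃[ k ] (Prime p × p ≢ 2 × q ≡ p Data.Nat.^ suc k)

Distinct : ∀ {A : Set} {n} → Vec A n → Set
Distinct {n = n} Y = ∀ (i j : Fin n) → lookup Y i ≡ lookup Y j → i ≡ j

module _ {q : ℕ} (F : FieldOn q) where
  open FieldOn F

  InShiftedSquares : Fin q → Fin q → Set
  InShiftedSquares x y = ∃[ z ] ((∃[ t ] (t ≢ 0# × z ≡ t * t)) × y ≡ z + x)

  Shatters : ∀ {n} → Vec (Fin q) n → Set
  Shatters {n} Y =
    ∀ (A : Fin n → Bool) →
      ∃[ x ] ((∀ j → lookup Y j ≢ x) ×
              (∀ j → (A j ≡ true) ⇔ InShiftedSquares x (lookup Y j)))

{-# OPTIONS --safe #-}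
-- Expanding ∏ (1 + s χ(y − x)), s = ±1, over y ∈ Y and summing over x ∈ 𝔽_q, χ the quadratic character,
-- reduces the claim to |∑ₓ χ(f(x))| = O(d √q) for f = ∏ (y − X) over a nonempty S ⊆ Y of size d.
-- With h = (q − 1)/2 this is a bound for the number of x with f(x)^h = ε, ε = ±1, obtained by Stepanov's
-- method. Consider P = ∑ⱼ (rⱼ + sⱼ f^h)(X^q − c)^j with f(c) ≠ 0 and rⱼ, sⱼ of degree below q/2. Instead of
-- Hasse derivatives we substitute X = a + f(a) U: then f(X) = f(a) ∏ (1 − f(a)/(y − a) U) and X^q ≡ a
-- modulo U^q, so when f(a)^h = ε every coefficient of P(a + f(a) U) below U^q is a polynomial in a of small
-- degree. There are more choices of (rⱼ, sⱼ) than of these coefficients, hence by the pigeonhole principle two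
-- P share the first ℓ of them; their difference is nonzero and has a zero of order ℓ at each such a.

module Submission where

open import Defs
open import Level using (0ℓ)
open import Algebra.Bundles using (CommutativeRing; RawRing)
open import Algebra.Morphism.Structures using (IsRingHomomorphism)
open import Algebra.Solver.Ring.AlmostCommutativeRing using (fromCommutativeRing; _-Raw-AlmostCommutative⟶_)
open import Data.Bool using (Bool; true; false; if_then_else_)
open import Data.Empty using (⊥-elim)
open import Data.Fin using (Fin; punchIn; toℕ; fromℕ<; combine; remQuot; splitAt; join; _↑ˡ_; _↑ʳ_; finToFun; funToFin) renaming (zero to fzero; suc to fsuc)
open import Data.List using (List; []; _∷_; length; map; take; tabulate; allFin; filter)
open import Data.List.Relation.Unary.All as All using (All; []; _∷_)
open import Data.List.Relation.Unary.AllPairs as AllPairs using ([]; _∷_)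
open import Data.List.Relation.Unary.Unique.Propositional using (Unique)
open import Data.Maybe using (Maybe; just; nothing)
open import Data.Nat as ℕ using (ℕ; zero; suc; _∸_; _≤_; _<_; z≤n; s≤s; NonZero)
open import Data.Nat.DivMod using (_/_; _%_; m≡m%n+[m/n]*n; m%n<n)
open import Data.Nat.Divisibility using (divides)
open import Data.Nat.Primality using (Prime; prime⇒irreducible)
open import Data.Nat.Tactic.RingSolver using (solve-∀)
open import Data.Product using (_×_; _,_; ∃-syntax; proj₁; proj₂)
open import Data.Sum using (_⊎_; inj₁; inj₂)
open import Data.Vec using (Vec; lookup)
open import Function using (_∘_)
open import Function.Bundles using (mk⇔)
open import Relation.Binary.PropositionalEquality as ≡ using (_≡_; _≢_)
open import Relation.Nullary using (yes; no; ¬_; ¬?)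
open import Relation.Unary using (Pred; Decidable)
import Algebra.Morphism.Construct.Identity as Identity
import Algebra.Properties.CommutativeMonoid.Sum
import Algebra.Properties.CommutativeSemigroup
import Algebra.Properties.CommutativeSemiring.Exp
import Algebra.Properties.Ring
import Algebra.Properties.Semiring.Exp
import Algebra.Properties.Semiring.Mult.TCOptimised
import Algebra.Solver.Ring
import Data.Fin.Permutation as Perm
import Data.Fin.Properties as Fin
import Data.Integer.Properties as ℤ
import Data.Integer.Tactic.RingSolver as ℤ-Solver
import Data.List.Properties as List
import Data.List.Relation.Unary.All.Properties as All
import Data.List.Relation.Unary.Unique.Propositional.Properties as Unique
import Data.Nat.Properties as ℕ
import Data.Vec.Functional as Vector
import Relation.Binary.Reasoning.Setoid

-- The constant 1/2 reflects square-root cancellation: each of the 2^n - 1 nontrivial terms of the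
-- expansion costs O(n √q), and 2^n n √q stays below q if 2^n is at most q^(1/2 - δ) with δ > 0
-- fixed and q large. Counting zeros gives only upper bounds, so both signs ε are counted; together
-- they confine the character sum. The shape of P comes from a balance: P has degree about Jq and ℓ
-- zeros at each counted point, so there are at most about Jq/ℓ points, and J close to √q with ℓ =
-- 2⌊√q⌋ makes this q/2 + O(d √q). The obstacle is that different choices must give different P,
-- although f^h has large degree and the blocks overlap. The base X^q - c resolves this: it is the
-- q-th power of X - c, so modulo (X - c)^q only the first block r + s f^h survives. Degrees below
-- q/2 keep r² f - f(c) s² below degree q. The characteristic may be as small as 3, so ordinary
-- derivatives cannot detect zeros of order ℓ; the expansion at a + f(a) U detects them by ring
-- identities alone.

-- Ring identities are decided with coefficients in ℕ × ℕ, the pair (m , n)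
-- standing for the integer m − n.
module DifferenceSolver {c ℓ} (R : CommutativeRing c ℓ) where
  open CommutativeRing R
  open Algebra.Properties.Ring ring using (-‿distribˡ-*; -‿distribʳ-*; -‿involutive; -0#≈0#; -‿+-comm)
  open Algebra.Properties.CommutativeSemigroup +-commutativeSemigroup using (interchange)
  open Algebra.Properties.Semiring.Mult.TCOptimised semiring using (×-homo-+; ×1-homo-*) renaming (_×_ to _·_)
  open Relation.Binary.Reasoning.Setoid setoid

  private
    -- The separate clause for second component zero makes `0 , 0` and `1 , 0` denote `0#` and `1#`
    -- definitionally, so that `:0` and `:1` match goals mentioning these elements.
    difference : ℕ × ℕ → Carrier
    difference (m , zero)  = m · 1#
    difference (m , suc n) = m · 1# + - (suc n · 1#)

    difference≈ : ∀ m n → difference (m , n) ≈ m · 1# + - (n · 1#)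
    difference≈ m zero    = sym (trans (+-congˡ -0#≈0#) (+-identityʳ _))
    difference≈ m (suc n) = refl

    +-difference : ∀ a b c d → (a + b) + - (c + d) ≈ (a + - c) + (b + - d)
    +-difference a b c d = trans (+-congˡ (sym (-‿+-comm c d))) (interchange a b (- c) (- d))

    *-difference : ∀ a b c d → (a * b + c * d) + - (a * d + c * b) ≈ (a + - c) * (b + - d)
    *-difference a b c d = sym (begin
      (a + - c) * (b + - d)                          ≈⟨ distribʳ _ _ _ ⟩
      a * (b + - d) + - c * (b + - d)                ≈⟨ +-cong (distribˡ _ _ _) (distribˡ _ _ _) ⟩
      (a * b + a * - d) + (- c * b + - c * - d)      ≈⟨ +-cong (+-congˡ (sym (-‿distribʳ-* a d))) (+-comm _ _) ⟩
      (a * b + - (a * d)) + (- c * - d + - c * b)    ≈⟨ +-congˡ (+-cong cd (sym (-‿distribˡ-* c b))) ⟩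
      (a * b + - (a * d)) + (c * d + - (c * b))      ≈⟨ sym (+-difference (a * b) (c * d) (a * d) (c * b)) ⟩
      (a * b + c * d) + - (a * d + c * b)            ∎)
      where
      cd : - c * - d ≈ c * d
      cd = trans (sym (-‿distribʳ-* (- c) d)) (trans (-‿cong (sym (-‿distribˡ-* c d))) (-‿involutive _))

    coefficients : RawRing _ _
    coefficients = record
      { Carrier = ℕ × ℕ
      ; _≈_     = _≡_
      ; _+_     = λ (a , c) (b , d) → a ℕ.+ b , c ℕ.+ d
      ; _*_     = λ (a , c) (b , d) → a ℕ.* b ℕ.+ c ℕ.* d , a ℕ.* d ℕ.+ c ℕ.* b
      ; -_      = λ (a , c) → c , a
      ; 0#      = 0 , 0
      ; 1#      = 1 , 0
      }

    morphism : coefficients -Raw-AlmostCommutative⟶ fromCommutativeRing R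
    morphism = record
      { ⟦_⟧    = difference
      ; +-homo = λ (a , c) (b , d) → begin
          difference (a ℕ.+ b , c ℕ.+ d)                  ≈⟨ difference≈ (a ℕ.+ b) (c ℕ.+ d) ⟩
          (a ℕ.+ b) · 1# + - ((c ℕ.+ d) · 1#)             ≈⟨ +-cong (×-homo-+ 1# a b) (-‿cong (×-homo-+ 1# c d)) ⟩
          (a · 1# + b · 1#) + - (c · 1# + d · 1#)         ≈⟨ +-difference _ _ _ _ ⟩
          (a · 1# + - (c · 1#)) + (b · 1# + - (d · 1#))   ≈⟨ +-cong (difference≈ a c) (difference≈ b d) ⟨
          difference (a , c) + difference (b , d)         ∎
      ; *-homo = λ (a , c) (b , d) → begin
          difference (a ℕ.* b ℕ.+ c ℕ.* d , a ℕ.* d ℕ.+ c ℕ.* b)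
            ≈⟨ difference≈ (a ℕ.* b ℕ.+ c ℕ.* d) (a ℕ.* d ℕ.+ c ℕ.* b) ⟩
          (a ℕ.* b ℕ.+ c ℕ.* d) · 1# + - ((a ℕ.* d ℕ.+ c ℕ.* b) · 1#)
            ≈⟨ +-cong (homo a b c d) (-‿cong (homo a d c b)) ⟩
          ((a · 1#) * (b · 1#) + (c · 1#) * (d · 1#)) + - ((a · 1#) * (d · 1#) + (c · 1#) * (b · 1#))
            ≈⟨ *-difference _ _ _ _ ⟩
          (a · 1# + - (c · 1#)) * (b · 1# + - (d · 1#))
            ≈⟨ *-cong (difference≈ a c) (difference≈ b d) ⟨
          difference (a , c) * difference (b , d)
            ∎
      ; -‿homo = λ (a , c) → begin
          difference (c , a)             ≈⟨ difference≈ c a ⟩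
          c · 1# + - (a · 1#)            ≈⟨ +-comm _ _ ⟩
          - (a · 1#) + c · 1#            ≈⟨ +-congˡ (-‿involutive _) ⟨
          - (a · 1#) + - (- (c · 1#))    ≈⟨ -‿+-comm _ _ ⟩
          - (a · 1# + - (c · 1#))        ≈⟨ -‿cong (difference≈ a c) ⟨
          - difference (a , c)           ∎
      ; 0-homo = refl
      ; 1-homo = refl
      }
      where
      homo : ∀ a b c d → (a ℕ.* b ℕ.+ c ℕ.* d) · 1# ≈ (a · 1#) * (b · 1#) + (c · 1#) * (d · 1#)
      homo a b c d = trans (×-homo-+ 1# (a ℕ.* b) (c ℕ.* d)) (+-cong (×1-homo-* a b) (×1-homo-* c d))

    difference-≟ : ∀ x y → Maybe (difference x ≈ difference y)
    difference-≟ (a , c) (b , d) with a ℕ.+ d ℕ.≟ b ℕ.+ c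
    ... | no  _ = nothing
    ... | yes e = just (begin
      difference (a , c)                              ≈⟨ difference≈ a c ⟩
      a · 1# + - (c · 1#)                             ≈⟨ +-identityʳ _ ⟨
      (a · 1# + - (c · 1#)) + 0#                      ≈⟨ +-congˡ (-‿inverseʳ _) ⟨
      (a · 1# + - (c · 1#)) + (d · 1# + - (d · 1#))   ≈⟨ +-difference _ _ _ _ ⟨
      (a · 1# + d · 1#) + - (c · 1# + d · 1#)         ≈⟨ +-cong swap (-‿cong (+-comm _ _)) ⟩
      (b · 1# + c · 1#) + - (d · 1# + c · 1#)         ≈⟨ +-difference _ _ _ _ ⟩
      (b · 1# + - (d · 1#)) + (c · 1# + - (c · 1#))   ≈⟨ +-congˡ (-‿inverseʳ _) ⟩
      (b · 1# + - (d · 1#)) + 0#                      ≈⟨ +-identityʳ _ ⟩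
      b · 1# + - (d · 1#)                             ≈⟨ difference≈ b d ⟨
      difference (b , d)                              ∎)
      where
      swap : a · 1# + d · 1# ≈ b · 1# + c · 1#
      swap = trans (sym (×-homo-+ 1# a d)) (trans (reflexive (≡.cong (_· 1#) e)) (×-homo-+ 1# b c))

  open Algebra.Solver.Ring coefficients (fromCommutativeRing R) morphism difference-≟ public
    using (solve; _:+_; _:*_; _:-_; :-_; _:=_; con)

  :0 :1 : ∀ {n} → Algebra.Solver.Ring.Polynomial coefficients (fromCommutativeRing R) morphism difference-≟ n
  :0 = con (0 , 0)
  :1 = con (1 , 0)

-- Formal power series over a commutative ring

module PowerSeries {c ℓ} (R : CommutativeRing c ℓ) where
  open CommutativeRing R
  open DifferenceSolver R using (solve; _:+_; _:*_; _:=_)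
  open Relation.Binary.Reasoning.Setoid setoid

  infix  4 _≋_
  infixl 6 _⊕_
  infixl 7 _⊛_

  Series : Set c
  Series = ℕ → Carrier

  _≋_ : Series → Series → Set ℓ
  p ≋ q = ∀ n → p n ≈ q n

  tail : Series → Series
  tail p n = p (suc n)

  0ₛ : Series
  0ₛ _ = 0#

  constant : Carrier → Series
  constant a zero    = a
  constant a (suc _) = 0#

  linear : Carrier → Carrier → Series
  linear a t zero    = a
  linear a t (suc n) = constant t n

  _⊕_ _⊛_ : Series → Series → Series
  (p ⊕ q) n = p n + q n
  (p ⊛ q) zero    = p 0 * q 0
  (p ⊛ q) (suc n) = p 0 * q (suc n) + (tail p ⊛ q) n

  ⊛-cong-≤ : ∀ n {p p′ q q′} → (∀ k → k ≤ n → p k ≈ p′ k) → (∀ k → k ≤ n → q k ≈ q′ k) → (p ⊛ q) n ≈ (p′ ⊛ q′) n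
  ⊛-cong-≤ zero    p≈ q≈ = *-cong (p≈ 0 z≤n) (q≈ 0 z≤n)
  ⊛-cong-≤ (suc n) p≈ q≈ = +-cong (*-cong (p≈ 0 z≤n) (q≈ (suc n) ℕ.≤-refl))
    (⊛-cong-≤ n (λ k k≤n → p≈ (suc k) (s≤s k≤n)) (λ k k≤n → q≈ k (ℕ.m≤n⇒m≤1+n k≤n)))

  ⊛-cong : ∀ {p p′ q q′} → p ≋ p′ → q ≋ q′ → (p ⊛ q) ≋ (p′ ⊛ q′)
  ⊛-cong p≋ q≋ n = ⊛-cong-≤ n (λ k _ → p≋ k) (λ k _ → q≋ k)

  ⊛-zeroˡ : ∀ q → (0ₛ ⊛ q) ≋ 0ₛ
  ⊛-zeroˡ q zero    = zeroˡ _
  ⊛-zeroˡ q (suc n) = trans (+-cong (zeroˡ _) (⊛-zeroˡ q n)) (+-identityˡ 0#)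

  constant-⊛ : ∀ a q n → (constant a ⊛ q) n ≈ a * q n
  constant-⊛ a q zero    = refl
  constant-⊛ a q (suc n) = trans (+-congˡ (⊛-zeroˡ q n)) (+-identityʳ _)

  linear-⊛ : ∀ a t q n → (linear a t ⊛ q) (suc n) ≈ a * q (suc n) + t * q n
  linear-⊛ a t q n = +-congˡ (constant-⊛ t q n)

  ⊛-distribʳ-⊕ : ∀ q p p′ → ((p ⊕ p′) ⊛ q) ≋ (p ⊛ q ⊕ p′ ⊛ q)
  ⊛-distribʳ-⊕ q p p′ zero    = distribʳ _ _ _
  ⊛-distribʳ-⊕ q p p′ (suc n) = trans (+-congˡ (⊛-distribʳ-⊕ q (tail p) (tail p′) n))
    (solve 5 (λ a b x y z → (a :+ b) :* x :+ (y :+ z) := (a :* x :+ y) :+ (b :* x :+ z)) refl _ _ _ _ _)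

  scale-⊛ : ∀ a p q n → ((λ k → a * p k) ⊛ q) n ≈ a * (p ⊛ q) n
  scale-⊛ a p q zero    = *-assoc _ _ _
  scale-⊛ a p q (suc n) = trans (+-congˡ (scale-⊛ a (tail p) q n))
    (solve 4 (λ a p q z → (a :* p) :* q :+ a :* z := a :* (p :* q :+ z)) refl _ _ _ _)

  -- `⊛` recurses on its left factor only; this mirror image, peeling off the constant term of the
  -- right factor, is what commutativity needs.
  ⊛-unfoldʳ : ∀ p q n → (p ⊛ q) (suc n) ≈ (p ⊛ tail q) n + p (suc n) * q 0
  ⊛-unfoldʳ p q zero    = refl
  ⊛-unfoldʳ p q (suc n) = trans (+-congˡ (⊛-unfoldʳ (tail p) q n)) (sym (+-assoc _ _ _))

  ⊛-comm : ∀ p q → (p ⊛ q) ≋ (q ⊛ p)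
  ⊛-comm p q zero    = *-comm _ _
  ⊛-comm p q (suc n) = begin
    p 0 * q (suc n) + (tail p ⊛ q) n    ≈⟨ +-cong (*-comm _ _) (⊛-comm (tail p) q n) ⟩
    q (suc n) * p 0 + (q ⊛ tail p) n    ≈⟨ +-comm _ _ ⟩
    (q ⊛ tail p) n + q (suc n) * p 0    ≈⟨ ⊛-unfoldʳ q p n ⟨
    (q ⊛ p) (suc n)                     ∎

  ⊛-assoc : ∀ p q r → ((p ⊛ q) ⊛ r) ≋ (p ⊛ (q ⊛ r))
  ⊛-assoc p q r zero    = *-assoc _ _ _
  ⊛-assoc p q r (suc n) = begin
    p 0 * q 0 * r (suc n) + (((λ k → p 0 * tail q k) ⊕ tail p ⊛ q) ⊛ r) n
      ≈⟨ +-congˡ (⊛-distribʳ-⊕ r _ _ n) ⟩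
    p 0 * q 0 * r (suc n) + (((λ k → p 0 * tail q k) ⊛ r) n + ((tail p ⊛ q) ⊛ r) n)
      ≈⟨ +-congˡ (+-cong (scale-⊛ (p 0) (tail q) r n) (⊛-assoc (tail p) q r n)) ⟩
    p 0 * q 0 * r (suc n) + (p 0 * (tail q ⊛ r) n + (tail p ⊛ (q ⊛ r)) n)
      ≈⟨ solve 5 (λ a b c d e → a :* b :* c :+ (a :* d :+ e) := a :* (b :* c :+ d) :+ e) refl _ _ _ _ _ ⟩
    p 0 * (q ⊛ r) (suc n) + (tail p ⊛ (q ⊛ r)) n
      ∎

  ⊛-identityˡ : ∀ p → (constant 1# ⊛ p) ≋ p
  ⊛-identityˡ p n = trans (constant-⊛ 1# p n) (*-identityˡ _)

  seriesRing : CommutativeRing c ℓ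
  seriesRing = record
    { Carrier = Series
    ; _≈_ = _≋_
    ; _+_ = _⊕_
    ; _*_ = _⊛_
    ; -_ = λ p n → - p n
    ; 0# = 0ₛ
    ; 1# = constant 1#
    ; isCommutativeRing = record
      { isRing = record
        { +-isAbelianGroup = record
          { isGroup = record
            { isMonoid = record
              { isSemigroup = record
                { isMagma = record
                  { isEquivalence = record
                    { refl = λ _ → refl ; sym = λ e n → sym (e n) ; trans = λ e e′ n → trans (e n) (e′ n) }
                  ; ∙-cong = λ e e′ n → +-cong (e n) (e′ n)
                  }
                ; assoc = λ p q r n → +-assoc _ _ _
                }
              ; identity = (λ p n → +-identityˡ _) , (λ p n → +-identityʳ _)
              }
            ; inverse = (λ p n → -‿inverseˡ _) , (λ p n → -‿inverseʳ _)
            ; ⁻¹-cong = λ e n → -‿cong (e n)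
            }
          ; comm = λ p q n → +-comm _ _
          }
        ; *-cong = ⊛-cong
        ; *-assoc = ⊛-assoc
        ; *-identity = ⊛-identityˡ , (λ p n → trans (⊛-comm p (constant 1#) n) (⊛-identityˡ p n))
        ; distrib = (λ p q r n → trans (⊛-comm p (q ⊕ r) n)
                      (trans (⊛-distribʳ-⊕ p q r n) (+-cong (⊛-comm q p n) (⊛-comm r p n))))
                  , ⊛-distribʳ-⊕
        }
      ; *-comm = ⊛-comm
      }
    }

  constant-isRingHomomorphism : IsRingHomomorphism rawRing (CommutativeRing.rawRing seriesRing) constant
  constant-isRingHomomorphism = record
    { isSemiringHomomorphism = record
      { isNearSemiringHomomorphism = record
        { +-isMonoidHomomorphism = record
          { isMagmaHomomorphism = record
            { isRelHomomorphism = record { cong = λ { e zero → e ; e (suc n) → refl } }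
            ; homo = λ { a b zero → refl ; a b (suc n) → sym (+-identityʳ 0#) }
            }
          ; ε-homo = λ { zero → refl ; (suc n) → refl }
          }
        ; *-homo = λ { a b zero → refl ; a b (suc n) → sym (trans (constant-⊛ a (constant b) (suc n)) (zeroʳ a)) }
        }
      ; 1#-homo = λ _ → refl
      }
    ; -‿homo = λ { a zero → refl ; a (suc n) → sym -0#≈0# }
    }
    where open Algebra.Properties.Ring ring using (-0#≈0#)

  infix 4 _≋_mod_
  _≋_mod_ : Series → Series → ℕ → Set ℓ
  p ≋ q mod m = ∀ k → k < m → p k ≈ q k

  ⊛-cong-mod : ∀ {m p p′ q q′} → p ≋ p′ mod m → q ≋ q′ mod m → p ⊛ q ≋ p′ ⊛ q′ mod m
  ⊛-cong-mod p≈ q≈ k k<m = ⊛-cong-≤ k (λ j j≤k → p≈ j (ℕ.≤-<-trans j≤k k<m)) (λ j j≤k → q≈ j (ℕ.≤-<-trans j≤k k<m))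

  open Algebra.Properties.Semiring.Exp (CommutativeRing.semiring seriesRing) public using () renaming (_^_ to _^ₛ_)

-- Polynomials as coefficient lists, their evaluation and division

module Polynomials {c ℓ} (R : CommutativeRing c ℓ) where
  open CommutativeRing R

  -- Lists are not normalised: trailing zeros are allowed, `length` only bounds the degree plus one,
  -- and a polynomial is zero when all values of `coeff` vanish.
  Poly : Set c
  Poly = List Carrier

  infixl 6 _⊞_ _⊟_
  infixl 7 _⊠_
  infixr 8 _^ₚ_

  scale : Carrier → Poly → Poly
  scale a = map (a *_)

  _⊞_ _⊟_ _⊠_ : Poly → Poly → Poly
  []      ⊞ q       = q
  (a ∷ p) ⊞ []      = a ∷ p
  (a ∷ p) ⊞ (b ∷ q) = (a + b) ∷ (p ⊞ q)
  p ⊟ q = p ⊞ scale (- 1#) q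
  []      ⊠ q = []
  (a ∷ p) ⊠ q = scale a q ⊞ (0# ∷ p ⊠ q)

  _^ₚ_ : Poly → ℕ → Poly
  p ^ₚ zero  = 1# ∷ []
  p ^ₚ suc n = p ⊠ p ^ₚ n

  coeff : Poly → ℕ → Carrier
  coeff []      _       = 0#
  coeff (a ∷ p) zero    = a
  coeff (a ∷ p) (suc n) = coeff p n

  coeff-≥length : ∀ p {i} → length p ≤ i → coeff p i ≈ 0#
  coeff-≥length []      _           = refl
  coeff-≥length (a ∷ p) (s≤s p≤i) = coeff-≥length p p≤i

  coeff-take : ∀ p {N i} → i < N → coeff (take N p) i ≈ coeff p i
  coeff-take []      {suc N} _           = refl
  coeff-take (a ∷ p) {suc N} {zero}  _         = refl
  coeff-take (a ∷ p) {suc N} {suc i} (s≤s i<N) = coeff-take p i<N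

  length-⊞ : ∀ {n} p q → length p ≤ n → length q ≤ n → length (p ⊞ q) ≤ n
  length-⊞ []      q       p≤n q≤n = q≤n
  length-⊞ (a ∷ p) []      p≤n q≤n = p≤n
  length-⊞ (a ∷ p) (b ∷ q) (s≤s p≤n) (s≤s q≤n) = s≤s (length-⊞ p q p≤n q≤n)

  length-scale : ∀ {n} a p → length p ≤ n → length (scale a p) ≤ n
  length-scale a p p≤n = ℕ.≤-trans (ℕ.≤-reflexive (List.length-map _ p)) p≤n

  length-⊟ : ∀ {n} p q → length p ≤ n → length q ≤ n → length (p ⊟ q) ≤ n
  length-⊟ p q p≤n q≤n = length-⊞ p _ p≤n (length-scale _ q q≤n)

  length-⊠ : ∀ {m n} p q → length p ≤ suc m → length q ≤ suc n → length (p ⊠ q) ≤ suc (m ℕ.+ n)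
  length-⊠ []      q p≤m q≤n = z≤n
  length-⊠ {zero} (a ∷ []) q p≤m q≤n = length-⊞ (scale a q) _ (length-scale a q q≤n) (s≤s z≤n)
  length-⊠ {zero} (a ∷ _ ∷ _) q (s≤s ()) q≤n
  length-⊠ {suc m} {n} (a ∷ p) q (s≤s p≤m) q≤n = length-⊞ (scale a q) _
    (length-scale a q (ℕ.≤-trans q≤n (s≤s (ℕ.m≤n+m n (suc m))))) (s≤s (length-⊠ p q p≤m q≤n))

  length-^ₚ : ∀ {m} p n → length p ≤ suc m → length (p ^ₚ n) ≤ suc (n ℕ.* m)
  length-^ₚ p zero    p≤m = s≤s z≤n
  length-^ₚ p (suc n) p≤m = length-⊠ p (p ^ₚ n) p≤m (length-^ₚ p n p≤m)

module Evaluation {c₁ ℓ₁ c₂ ℓ₂} (R : CommutativeRing c₁ ℓ₁) (A : CommutativeRing c₂ ℓ₂)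
  (ι : CommutativeRing.Carrier R → CommutativeRing.Carrier A)
  (ι-homo : IsRingHomomorphism (CommutativeRing.rawRing R) (CommutativeRing.rawRing A) ι) where
  private module R = CommutativeRing R
  open CommutativeRing A
  open Polynomials R
  open IsRingHomomorphism ι-homo
  open DifferenceSolver A using (solve; _:+_; _:*_; _:=_; :-_; :0; :1)
  open Algebra.Properties.Semiring.Exp semiring using (_^_)
  open Relation.Binary.Reasoning.Setoid setoid

  -- With `A` the field itself this is the value at a point; with `A` the series ring it is the
  -- substitution behind the local expansions.
  eval : Poly → Carrier → Carrier
  eval []      z = 0#
  eval (a ∷ p) z = ι a + z * eval p z

  eval-coeff-0 : ∀ p z → (∀ i → coeff p i R.≈ R.0#) → eval p z ≈ 0#
  eval-coeff-0 []      z e = refl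
  eval-coeff-0 (a ∷ p) z e = trans (+-cong (trans (⟦⟧-cong (e 0)) 0#-homo) (*-congˡ (eval-coeff-0 p z (e ∘ suc))))
    (solve 1 (λ z → :0 :+ z :* :0 := :0) refl z)

  eval-coeff : ∀ p q z → (∀ i → coeff p i R.≈ coeff q i) → eval p z ≈ eval q z
  eval-coeff []      q       z e = sym (eval-coeff-0 q z (R.sym ∘ e))
  eval-coeff (a ∷ p) []      z e = eval-coeff-0 (a ∷ p) z e
  eval-coeff (a ∷ p) (b ∷ q) z e = +-cong (⟦⟧-cong (e 0)) (*-congˡ (eval-coeff p q z (e ∘ suc)))

  eval-⊞ : ∀ p q z → eval (p ⊞ q) z ≈ eval p z + eval q z
  eval-⊞ []      q       z = sym (+-identityˡ _)
  eval-⊞ (a ∷ p) []      z = sym (+-identityʳ _)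
  eval-⊞ (a ∷ p) (b ∷ q) z = trans (+-cong (+-homo a b) (*-congˡ (eval-⊞ p q z)))
    (solve 5 (λ a b z p q → (a :+ b) :+ z :* (p :+ q) := (a :+ z :* p) :+ (b :+ z :* q)) refl _ _ _ _ _)

  eval-scale : ∀ a p z → eval (scale a p) z ≈ ι a * eval p z
  eval-scale a []      z = sym (zeroʳ _)
  eval-scale a (b ∷ p) z = trans (+-cong (*-homo a b) (*-congˡ (eval-scale a p z)))
    (solve 4 (λ a b z p → a :* b :+ z :* (a :* p) := a :* (b :+ z :* p)) refl _ _ _ _)

  eval-⊟ : ∀ p q z → eval (p ⊟ q) z ≈ eval p z + - eval q z
  eval-⊟ p q z = trans (eval-⊞ p _ z) (+-congˡ (trans (eval-scale _ q z)
    (trans (*-congʳ (trans (-‿homo R.1#) (-‿cong 1#-homo))) (solve 1 (λ x → :- :1 :* x := :- x) refl _))))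

  eval-⊠ : ∀ p q z → eval (p ⊠ q) z ≈ eval p z * eval q z
  eval-⊠ []      q z = sym (zeroˡ _)
  eval-⊠ (a ∷ p) q z = begin
    eval (scale a q ⊞ (R.0# ∷ p ⊠ q)) z                    ≈⟨ eval-⊞ (scale a q) _ z ⟩
    eval (scale a q) z + (ι R.0# + z * eval (p ⊠ q) z)     ≈⟨ +-cong (eval-scale a q z)
        (+-cong 0#-homo (*-congˡ (eval-⊠ p q z))) ⟩
    ι a * eval q z + (0# + z * (eval p z * eval q z))      ≈⟨ solve 4
        (λ a p q z → a :* q :+ (:0 :+ z :* (p :* q)) := (a :+ z :* p) :* q) refl _ _ _ _ ⟩
    (ι a + z * eval p z) * eval q z                        ∎

  eval-[a] : ∀ a z → eval (a ∷ []) z ≈ ι a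
  eval-[a] a z = trans (+-congˡ (zeroʳ z)) (+-identityʳ _)

  eval-[a,b] : ∀ a b z → eval (a ∷ b ∷ []) z ≈ ι a + z * ι b
  eval-[a,b] a b z = +-congˡ (*-congˡ (eval-[a] b z))

  eval-^ₚ : ∀ p n z → eval (p ^ₚ n) z ≈ eval p z ^ n
  eval-^ₚ p zero    z = trans (eval-[a] _ z) 1#-homo
  eval-^ₚ p (suc n) z = trans (eval-⊠ p _ z) (*-congˡ (eval-^ₚ p n z))

module SyntheticDivision {c₁ ℓ₁} (R : CommutativeRing c₁ ℓ₁) where
  private module R = CommutativeRing R
  open Polynomials R

  open Evaluation R R (λ x → x) (Identity.isRingHomomorphism R.rawRing R.refl) public using () renaming
    (eval to value; eval-coeff to value-coeff; eval-⊞ to value-⊞; eval-scale to value-scale; eval-⊟ to value-⊟; eval-⊠ to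
        value-⊠;
     eval-[a] to value-[a]; eval-[a,b] to value-[a,b]; eval-^ₚ to value-^ₚ)

  -- Horner's scheme for division by X - a: the intermediate values at a are the coefficients of the
  -- quotient.
  quotient : Poly → R.Carrier → Poly
  quotient []          a = []
  quotient (b ∷ [])    a = []
  quotient (b ∷ c ∷ p) a = value (c ∷ p) a ∷ quotient (c ∷ p) a

  length-quotient : ∀ b p a → length (quotient (b ∷ p) a) ≡ length p
  length-quotient b []      a = ≡.refl
  length-quotient b (c ∷ p) a = ≡.cong suc (length-quotient c p a)

  module _ {c₂ ℓ₂} (A : CommutativeRing c₂ ℓ₂)
    (ι : CommutativeRing.Carrier R → CommutativeRing.Carrier A)
    (ι-homo : IsRingHomomorphism (CommutativeRing.rawRing R) (CommutativeRing.rawRing A) ι) where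
    open CommutativeRing A
    open Evaluation R A ι ι-homo using (eval)
    open IsRingHomomorphism ι-homo
    open DifferenceSolver A using (solve; _:+_; _:*_; _:=_; :-_; :0)

    eval-division : ∀ p a z → eval p z ≈ ι (value p a) + (z + - ι a) * eval (quotient p a) z
    eval-division []          a z = trans (solve 2 (λ z a → :0 := :0 :+ (z :+ :- a) :* :0) refl z (ι a))
        (+-congʳ (sym 0#-homo))
    eval-division (b ∷ [])    a z = trans (solve 3 (λ z a b → b :+ z :* :0 := (b :+ a :* :0) :+ (z :+ :- a) :* :0) refl z
        (ι a) (ι b))
      (+-congʳ (sym (trans (+-homo _ _) (+-congˡ (trans (*-homo _ _) (*-congˡ 0#-homo))))))
    eval-division (b ∷ c ∷ p) a z = trans (+-congˡ (*-congˡ (eval-division (c ∷ p) a z)))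
      (trans (solve 5 (λ b z a v q → b :+ z :* (v :+ (z :+ :- a) :* q) := (b :+ a :* v) :+ (z :+ :- a) :* (v :+ z :* q)) refl
          _ _ _ _ _)
        (+-congʳ (sym (trans (+-homo _ _) (+-congˡ (*-homo _ _))))))

open ≡ using (refl; sym; trans; cong; cong₂; subst; module ≡-Reasoning)

-- Orders of zeros and the root count over a field

module FieldAlgebra {q : ℕ} (F : FieldOn q) where
  open FieldOn F using (0#; 1#; _+_; _*_; -_; 0≢1; inverse)

  fieldRing : CommutativeRing 0ℓ 0ℓ
  fieldRing = record { isCommutativeRing = FieldOn.isCommutativeRing F }

  open CommutativeRing fieldRing
    using (ring; *-identityˡ; *-identityʳ; +-identityˡ; +-identityʳ; zeroˡ; zeroʳ; -‿inverseʳ; commutativeSemiring)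
  open Algebra.Properties.Ring ring public using (-0#≈0#; -‿injective)
  open Algebra.Properties.CommutativeSemiring.Exp commutativeSemiring public
    using (_^_; ^-homo-*; ^-distrib-*)
  open PowerSeries fieldRing public
  open Polynomials fieldRing public
  open SyntheticDivision fieldRing public
  module S = CommutativeRing seriesRing
  open Evaluation fieldRing seriesRing constant constant-isRingHomomorphism public
  module FSolver = DifferenceSolver fieldRing
  module SSolver = DifferenceSolver seriesRing

  *-cancel-0 : ∀ {x y} → x ≢ 0# → x * y ≡ 0# → y ≡ 0#
  *-cancel-0 {x} {y} x≢0 xy≡0 with x⁻¹ , xx⁻¹≡1 ← inverse x x≢0 = begin
    y                ≡⟨ sym (*-identityˡ y) ⟩
    1# * y           ≡⟨ cong (_* y) (sym xx⁻¹≡1) ⟩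
    (x * x⁻¹) * y    ≡⟨ FSolver.solve 3 (λ x i y → (x FSolver.:* i) FSolver.:* y FSolver.:= i FSolver.:* (x FSolver.:* y))
        refl x x⁻¹ y ⟩
    x⁻¹ * (x * y)    ≡⟨ cong (x⁻¹ *_) xy≡0 ⟩
    x⁻¹ * 0#         ≡⟨ zeroʳ x⁻¹ ⟩
    0#               ∎
    where open ≡-Reasoning

  *-≢0 : ∀ {x y} → x ≢ 0# → y ≢ 0# → x * y ≢ 0#
  *-≢0 x≢0 y≢0 xy≡0 = y≢0 (*-cancel-0 x≢0 xy≡0)

  -≡0 : ∀ {y z} → y + - z ≡ 0# → y ≡ z
  -≡0 {y} {z} e = trans (solve 2 (λ y z → y := (y :+ :- z) :+ z) refl y z) (trans (cong (_+ z) e) (+-identityˡ z))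
    where open FSolver

  *-cancelˡ : ∀ {x y z} → x ≢ 0# → x * y ≡ x * z → y ≡ z
  *-cancelˡ {x} {y} {z} x≢0 e = -≡0 (*-cancel-0 x≢0 (begin
    x * (y + - z)       ≡⟨ solve 3 (λ x y z → x :* (y :+ :- z) := x :* y :+ :- (x :* z)) refl x y z ⟩
    x * y + - (x * z)   ≡⟨ cong (λ w → w + - (x * z)) e ⟩
    x * z + - (x * z)   ≡⟨ -‿inverseʳ _ ⟩
    0#                  ∎))
    where
    open ≡-Reasoning
    open FSolver

  ≡⇒-≡0 : ∀ {y z} → y ≡ z → y + - z ≡ 0#
  ≡⇒-≡0 {z = z} refl = -‿inverseʳ z

  -≢0 : ∀ {y z} → y ≢ z → y + - z ≢ 0#
  -≢0 y≢z e = y≢z (-≡0 e)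

  U : Series
  U = linear 0# 1#

  -- A series with nonzero constant term is a unit, so cancelling it loses no precision; cancelling
  -- t U, as in `linear0-cancel-mod`, loses exactly one order.
  linear-cancel-mod : ∀ {a t w} m → a ≢ 0# → linear a t ⊛ w ≋ 0ₛ mod m → w ≋ 0ₛ mod m
  linear-cancel-mod {a} {t} {w} m a≢0 e = go
    where
    go : ∀ k → k < m → w k ≡ 0#
    go zero    k<m = *-cancel-0 a≢0 (e 0 k<m)
    go (suc k) k<m = *-cancel-0 a≢0 (begin
      a * w (suc k)              ≡⟨ sym (+-identityʳ _) ⟩
      a * w (suc k) + 0#         ≡⟨ cong (a * w (suc k) +_) (sym (zeroʳ t)) ⟩
      a * w (suc k) + t * 0#     ≡⟨ cong (λ v → a * w (suc k) + t * v) (sym (go k (ℕ.<⇒≤ k<m))) ⟩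
      a * w (suc k) + t * w k    ≡⟨ sym (linear-⊛ a t w k) ⟩
      (linear a t ⊛ w) (suc k)   ≡⟨ e (suc k) k<m ⟩
      0#                         ∎)
      where open ≡-Reasoning

  linear0-⊛ : ∀ t w k → (linear 0# t ⊛ w) (suc k) ≡ t * w k
  linear0-⊛ t w k = trans (linear-⊛ 0# t w k) (trans (cong (_+ t * w k) (zeroˡ _)) (+-identityˡ _))

  linear0-cancel-mod : ∀ {t w} m → t ≢ 0# → linear 0# t ⊛ w ≋ 0ₛ mod suc m → w ≋ 0ₛ mod m
  linear0-cancel-mod {t} {w} m t≢0 e k k<m = *-cancel-0 t≢0 (trans (sym (linear0-⊛ t w k)) (e (suc k) (s≤s k<m)))

  U-cancel : ∀ {v w} → U ⊛ v ≋ U ⊛ w → v ≋ w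
  U-cancel {v} {w} e k = begin
    v k                  ≡⟨ sym (*-identityˡ _) ⟩
    1# * v k             ≡⟨ sym (linear0-⊛ 1# v k) ⟩
    (U ⊛ v) (suc k)      ≡⟨ e (suc k) ⟩
    (U ⊛ w) (suc k)      ≡⟨ linear0-⊛ 1# w k ⟩
    1# * w k             ≡⟨ *-identityˡ _ ⟩
    w k                  ∎
    where open ≡-Reasoning

  U⊛tail : ∀ w → w 0 ≡ 0# → w ≋ U ⊛ tail w
  U⊛tail w e zero    = trans e (sym (zeroˡ _))
  U⊛tail w e (suc k) = sym (trans (linear0-⊛ 1# (tail w) k) (*-identityˡ _))

  linear-+ : ∀ b t a → linear b t ⊕ (S.- constant a) ≋ linear (b + - a) t
  linear-+ b t a zero    = refl
  linear-+ b t a (suc n) = trans (cong (constant t n +_) -0#≈0#) (+-identityʳ _)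

  linear≋ : ∀ a t → linear a t ≋ constant a ⊕ U ⊛ constant t
  linear≋ a t zero    = sym (trans (cong (a +_) (zeroˡ t)) (+-identityʳ a))
  linear≋ a t (suc n) = sym (trans (+-identityˡ _) (trans (linear0-⊛ 1# (constant t) n) (*-identityˡ _)))

  constant-0 : constant 0# ≋ 0ₛ
  constant-0 zero    = refl
  constant-0 (suc n) = refl

  constant-cong : ∀ {x y} → x ≡ y → constant x ≋ constant y
  constant-cong refl n = refl

  -- Substituting the variable for itself identifies a list with its series, so that coefficient
  -- identities follow from evaluations at `U` in the series ring.
  coeff≡eval : ∀ p i → coeff p i ≡ eval p U i
  coeff≡eval []      i       = refl
  coeff≡eval (a ∷ p) zero    = sym (trans (cong (a +_) (zeroˡ _)) (+-identityʳ a))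
  coeff≡eval (a ∷ p) (suc i) = trans (coeff≡eval p i) (sym (trans (+-identityˡ _)
      (trans (linear0-⊛ 1# (eval p U) i) (*-identityˡ _))))

  eval-division′ : ∀ p a z → eval p z ≋ constant (value p a) ⊕ (z ⊕ (S.- constant a)) ⊛ eval (quotient p a) z
  eval-division′ = eval-division seriesRing constant constant-isRingHomomorphism

  eval-at : ∀ p a t → eval p (linear a t) 0 ≡ value p a
  eval-at p a t = begin
    eval p (linear a t) 0                          ≡⟨ eval-division′ p a (linear a t) 0 ⟩
    value p a + (a + - a) * eval (quotient p a) (linear a t) 0  ≡⟨ cong
        (λ w → value p a + w * eval (quotient p a) (linear a t) 0) (-‿inverseʳ a) ⟩
    value p a + 0# * eval (quotient p a) (linear a t) 0         ≡⟨ cong (value p a +_) (zeroˡ _) ⟩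
    value p a + 0#                                 ≡⟨ +-identityʳ _ ⟩
    value p a                                      ∎
    where open ≡-Reasoning

  eval-root : ∀ p a b t → value p a ≡ 0# → eval p (linear b t) ≋ linear (b + - a) t ⊛ eval (quotient p a) (linear b t)
  eval-root p a b t e = S.trans (eval-division′ p a (linear b t))
    (S.trans (S.+-cong (S.trans (constant-cong e) constant-0) (S.*-congʳ (linear-+ b t a))) (S.+-identityˡ _))

  -- p has a root of order at least m at a; allowing an arbitrary nonzero slope t makes the
  -- substitution z = a + f(a) U directly usable.
  RootOrder : Poly → Fin q → ℕ → Set
  RootOrder p a m = ∃[ t ] (t ≢ 0# × eval p (linear a t) ≋ 0ₛ mod m)

  rootOrder-1 : ∀ p a → value p a ≡ 0# → RootOrder p a 1
  rootOrder-1 p a e = 1# , 0≢1 ∘ sym , λ { zero _ → trans (eval-at p a 1#) e ; (suc _) (s≤s ()) }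

  -- Here m is the multiplicity not yet used up at the current root a, while each later root has ℓ.
  -- Dividing by X - a lowers both sides of the length bound by one and preserves the order at b ≠
  -- a, where X - a is a unit. Once m is zero, the next entry of `zs` takes over.
  roots⇒0 : ∀ ℓ zs m p a → RootOrder p a m → All (a ≢_) zs → Unique zs → All (λ b → RootOrder p b ℓ) zs →
            length p ≤ m ℕ.+ length zs ℕ.* ℓ → ∀ i → coeff p i ≡ 0#
  roots⇒0 ℓ []       zero    []      a _ _ _ _ _ i = refl
  roots⇒0 ℓ (b ∷ zs) zero    p       a _ _ (b∉zs ∷ u) (root ∷ roots) p≤ i = roots⇒0 ℓ zs ℓ p b root b∉zs u roots p≤ i
  roots⇒0 ℓ zs       (suc m) []      a _ _ _ _ _ i = refl
  roots⇒0 ℓ zs       (suc m) p@(c ∷ p′) a (t , t≢0 , e) a∉zs u roots (s≤s p≤) i = begin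
    coeff p i                          ≡⟨ coeff≡eval p i ⟩
    eval p U i                         ≡⟨ eval-root p a 0# 1# p[a]≡0 i ⟩
    (linear (0# + - a) 1# ⊛ eval r U) i  ≡⟨ S.*-congˡ {linear (0# + - a) 1#} (eval-coeff-0 r U r≡0) i ⟩
    (linear (0# + - a) 1# ⊛ 0ₛ) i        ≡⟨ S.zeroʳ (linear (0# + - a) 1#) i ⟩
    0#                                 ∎
    where
    open ≡-Reasoning
    r : Poly
    r = quotient p a
    p[a]≡0 : value p a ≡ 0#
    p[a]≡0 = trans (sym (eval-at p a t)) (e 0 (s≤s z≤n))
    other : ∀ {b} → a ≢ b × RootOrder p b ℓ → RootOrder r b ℓ
    other {b} (a≢b , s , s≢0 , e) = s , s≢0 , linear-cancel-mod ℓ (-≢0 (a≢b ∘ sym))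
      (λ k k<ℓ → trans (sym (eval-root p a b s p[a]≡0 k)) (e k k<ℓ))
    this : RootOrder r a m
    this = t , t≢0 , linear0-cancel-mod m t≢0
      (λ k k<m → trans (sym (trans (eval-root p a a t p[a]≡0 k) (S.*-congʳ {eval r (linear a t)} lin≋ k))) (e k k<m))
      where
      lin≋ : linear (a + - a) t ≋ linear 0# t
      lin≋ zero    = -‿inverseʳ a
      lin≋ (suc _) = refl
    r≡0 : ∀ i → coeff r i ≡ 0#
    r≡0 = roots⇒0 ℓ zs m r a this a∉zs u (All.zipWith other (a∉zs , roots))
            (ℕ.≤-trans (ℕ.≤-reflexive (length-quotient c p′ a)) p≤)

  highRoots⇒0 : ∀ ℓ zs p → Unique zs → All (λ b → RootOrder p b ℓ) zs → length p ≤ length zs ℕ.* ℓ → ∀ i → coeff p i ≡ 0#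
  highRoots⇒0 ℓ []       []      _ _ _ i = refl
  highRoots⇒0 ℓ (a ∷ zs) p (a∉zs ∷ u) (root ∷ roots) p≤ = roots⇒0 ℓ zs ℓ p a root a∉zs u roots p≤

  simpleRoots⇒0 : ∀ zs p → Unique zs → All (λ b → value p b ≡ 0#) zs → length p ≤ length zs → ∀ i → coeff p i ≡ 0#
  simpleRoots⇒0 zs p u roots p≤ = highRoots⇒0 1 zs p u (All.map (rootOrder-1 p _) roots)
    (ℕ.≤-trans p≤ (ℕ.≤-reflexive (sym (ℕ.*-identityʳ _))))

  coeff-0⇒value-0 : ∀ p x → (∀ i → coeff p i ≡ 0#) → value p x ≡ 0#
  coeff-0⇒value-0 p x e = trans (sym (eval-at p x 0#)) (eval-coeff-0 p (linear x 0#) e 0)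

  -- `length` does not see cancellation among top coefficients, so the list is first cut at N; by
  -- the last hypothesis the cut changes no coefficient.
  degree<N⇒0 : ∀ N zs p → Unique zs → All (λ b → value p b ≡ 0#) zs → N ≤ length zs →
               (∀ i → N ≤ i → coeff p i ≡ 0#) → ∀ i → coeff p i ≡ 0#
  degree<N⇒0 N zs p u roots N≤ high i = trans (sym (take≡ i)) (simpleRoots⇒0 zs (take N p) u
    (All.map (λ {b} e → trans (value-coeff (take N p) p b take≡) e) roots) (ℕ.≤-trans take≤N N≤) i)
    where
    take≤N : length (take N p) ≤ N
    take≤N = ℕ.≤-trans (ℕ.≤-reflexive (List.length-take N p)) (ℕ.m⊓n≤m N _)
    take≡ : ∀ i → coeff (take N p) i ≡ coeff p i
    take≡ i with i ℕ.<? N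
    ... | yes i<N = coeff-take p i<N
    ... | no  i≮N = trans (coeff-≥length (take N p) (ℕ.≤-trans take≤N (ℕ.≮⇒≥ i≮N))) (sym (high i (ℕ.≮⇒≥ i≮N)))

-- Fermat's theorem and q-th powers of linear series

module Fermat {n : ℕ} (F : FieldOn (suc n)) where
  open FieldOn F using (0#; 1#; _+_; _*_; -_; 0≢1; inverse)
  open FieldAlgebra F
  open CommutativeRing fieldRing
    using (*-comm; *-assoc; *-identityˡ; *-identityʳ; +-identityˡ; +-identityʳ; zeroˡ; zeroʳ; *-commutativeMonoid)
  open Algebra.Properties.CommutativeMonoid.Sum *-commutativeMonoid
    using () renaming (sum to ∏; sum-remove to ∏-remove; sum-permute to ∏-permute; ∑-distrib-+ to ∏-distrib-*; sum-replicate
        to ∏-replicate; sum-cong-≗ to ∏-cong)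

  unit : Fin n → Fin (suc n)
  unit = punchIn 0#

  unit≢0 : ∀ i → unit i ≢ 0#
  unit≢0 = Fin.punchInᵢ≢i 0#

  units : List (Fin (suc n))
  units = tabulate unit

  length-units : length units ≡ n
  length-units = List.length-tabulate unit

  x≢0⇒x^[q-1]≡1 : ∀ x → x ≢ 0# → x ^ n ≡ 1#
  x≢0⇒x^[q-1]≡1 x x≢0 with x⁻¹ , xx⁻¹≡1 ← inverse x x≢0 = *-cancelˡ ∏unit≢0 (begin
    ∏ unit * x ^ n                          ≡⟨ *-comm _ _ ⟩
    x ^ n * ∏ unit                          ≡⟨ cong (_* ∏ unit) (sym (∏-replicate n)) ⟩
    ∏ (Vector.replicate n x) * ∏ unit       ≡⟨ sym (∏-distrib-* (Vector.replicate n x) unit) ⟩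
    ∏ (λ i → x * unit i)                    ≡⟨ ∏-cong {n} (λ i → sym (φ-≢0 (*-≢0 x≢0 (unit≢0 i)))) ⟩
    ∏ (λ i → φ (x * unit i))                ≡⟨ sym (*-identityˡ _) ⟩
    1# * ∏ (λ i → φ (x * unit i))           ≡⟨ cong (_* ∏ (λ i → φ (x * unit i))) (sym (trans (cong φ (zeroʳ x)) φ-0)) ⟩
    φ (x * 0#) * ∏ (λ i → φ (x * unit i))   ≡⟨ sym (∏-remove {n} {0#} (λ y → φ (x * y))) ⟩
    ∏ (λ y → φ (x * y))                     ≡⟨ sym (∏-permute φ π) ⟩
    ∏ φ                                     ≡⟨ ∏-remove {n} {0#} φ ⟩
    φ 0# * ∏ (λ i → φ (unit i))             ≡⟨ cong₂ _*_ φ-0 (∏-cong {n} (φ-≢0 ∘ unit≢0)) ⟩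
    1# * ∏ unit                             ≡⟨ *-comm _ _ ⟩
    ∏ unit * 1#                             ∎)
    where
    open ≡-Reasoning
    -- Replacing 0 by 1 turns the product of the units into a product over the whole field, which
    -- multiplication by x permutes.
    φ : Fin (suc n) → Fin (suc n)
    φ y with y Fin.≟ 0#
    ... | yes _ = 1#
    ... | no  _ = y
    φ-0 : φ 0# ≡ 1#
    φ-0 with 0# Fin.≟ 0#
    ... | yes _ = refl
    ... | no  e = ⊥-elim (e refl)
    φ-≢0 : ∀ {y} → y ≢ 0# → φ y ≡ y
    φ-≢0 {y} y≢0 with y Fin.≟ 0#
    ... | yes e = ⊥-elim (y≢0 e)
    ... | no  _ = refl
    π : Perm.Permutation (suc n) (suc n)
    π = Perm.permutation (x *_) (x⁻¹ *_)
      (λ y → trans (sym (*-assoc x x⁻¹ y)) (trans (cong (_* y) xx⁻¹≡1) (*-identityˡ y)))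
      (λ y → trans (sym (*-assoc x⁻¹ x y)) (trans (cong (_* y) (trans (*-comm x⁻¹ x) xx⁻¹≡1)) (*-identityˡ y)))
    ∏-≢0 : ∀ {m} (f : Fin m → Fin (suc n)) → (∀ i → f i ≢ 0#) → ∏ f ≢ 0#
    ∏-≢0 {zero}  f f≢0 = 0≢1 ∘ sym
    ∏-≢0 {suc m} f f≢0 = *-≢0 (f≢0 fzero) (∏-≢0 (f ∘ fsuc) (f≢0 ∘ fsuc))
    ∏unit≢0 : ∏ unit ≢ 0#
    ∏unit≢0 = ∏-≢0 unit unit≢0

  x^q≡x : ∀ x → x ^ suc n ≡ x
  x^q≡x x with x Fin.≟ 0#
  ... | yes refl = zeroˡ _
  ... | no  x≢0  = trans (cong (x *_) (x≢0⇒x^[q-1]≡1 x x≢0)) (*-identityʳ x)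

  linear-^-top : ∀ a t m → (linear a t ^ₛ m) m ≡ t ^ m × (∀ k → m < k → (linear a t ^ₛ m) k ≡ 0#)
  linear-^-top a t zero    = refl , λ { (suc k) _ → refl }
  linear-^-top a t (suc m) with top , high ← linear-^-top a t m =
    trans (linear-⊛ a t _ m) (trans (cong₂ _+_ (trans (cong (a *_) (high (suc m) ℕ.≤-refl)) (zeroʳ a)) (cong (t *_) top))
        (+-identityˡ _)) ,
    λ { (suc k) (s≤s m<k) → trans (linear-⊛ a t _ k) (trans (cong₂ _+_
        (trans (cong (a *_) (high (suc k) (ℕ.m≤n⇒m≤1+n m<k))) (zeroʳ a)) (trans (cong (t *_) (high k m<k)) (zeroʳ t)))
            (+-identityˡ _)) }

  U^-low : ∀ m k → k < m → (U ^ₛ m) k ≡ 0#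
  U^-low (suc m) zero    _         = zeroˡ _
  U^-low (suc m) (suc k) (s≤s k<m) = trans (linear0-⊛ 1# (U ^ₛ m) k) (trans (*-identityˡ _) (U^-low m k k<m))

  module Exp = Algebra.Properties.CommutativeSemiring.Exp S.commutativeSemiring

  -- (a + tU)^q − tU^q − a has degree below q and, by Fermat, vanishes on the whole field.
  linear-^q : ∀ a t → linear a t ^ₛ suc n ≋ constant a ⊕ constant t ⊛ (U ^ₛ suc n)
  linear-^q a t k = -≡0 (trans (sym (evalD k)) (trans (sym (coeff≡eval D k)) (D≡0 k)))
    where
    q = suc n
    Xᵠ D : Poly
    Xᵠ = (0# ∷ 1# ∷ []) ^ₚ q
    D = (a ∷ t ∷ []) ^ₚ q ⊟ ((a ∷ []) ⊞ scale t Xᵠ)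
    evalX : eval (0# ∷ 1# ∷ []) U ≋ U
    evalX = S.trans (eval-[a,b] 0# 1# U) (S.sym (linear≋ 0# 1#))
    evalD : eval D U ≋ linear a t ^ₛ q ⊕ (S.- (constant a ⊕ constant t ⊛ (U ^ₛ q)))
    evalD = S.trans (eval-⊟ ((a ∷ t ∷ []) ^ₚ q) _ U) (S.+-cong
      (S.trans (eval-^ₚ (a ∷ t ∷ []) q U) (Exp.^-congˡ q (S.trans (eval-[a,b] a t U) (S.sym (linear≋ a t)))))
      (S.-‿cong (S.trans (eval-⊞ (a ∷ []) (scale t Xᵠ) U) (S.+-cong (eval-[a] a U)
        (S.trans (eval-scale t Xᵠ U) (S.*-congˡ {constant t} (S.trans (eval-^ₚ (0# ∷ 1# ∷ []) q U)
            (Exp.^-congˡ q evalX))))))))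
    -- At index q itself both terms of `D` contribute; the coefficient is t^q - t · 1^q and vanishes
    -- by Fermat.
    high : ∀ i → q ≤ i → coeff D i ≡ 0#
    high i q≤i = trans (coeff≡eval D i) (trans (evalD i) (≡⇒-≡0 (trans (lin≡ i (ℕ.m≤n⇒m<n∨m≡n q≤i))
      (trans (sym (+-identityˡ _)) (cong₂ _+_ (const≡ i q≤i) (sym (constant-⊛ t (U ^ₛ q) i)))))))
      where
      const≡ : ∀ i → q ≤ i → 0# ≡ constant a i
      const≡ (suc i) _ = refl
      lin≡ : ∀ i → q < i ⊎ q ≡ i → (linear a t ^ₛ q) i ≡ t * (U ^ₛ q) i
      lin≡ i (inj₁ q<i) = trans (proj₂ (linear-^-top a t q) i q<i)
          (sym (trans (cong (t *_) (proj₂ (linear-^-top 0# 1# q) i q<i)) (zeroʳ t)))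
      lin≡ i (inj₂ refl) = trans (proj₁ (linear-^-top a t q))
          (trans (x^q≡x t) (sym (trans (cong (t *_) (trans (proj₁ (linear-^-top 0# 1# q)) (x^q≡x 1#))) (*-identityʳ t))))
    valueD : ∀ x → value D x ≡ 0#
    valueD x = begin
      value D x
        ≡⟨ value-⊟ ((a ∷ t ∷ []) ^ₚ q) _ x ⟩
      value ((a ∷ t ∷ []) ^ₚ q) x + - value ((a ∷ []) ⊞ scale t Xᵠ) x
        ≡⟨ cong₂ (λ u v → u + - v) (frobenius a t) (trans (value-⊞ (a ∷ []) (scale t Xᵠ) x)
            (cong₂ _+_ (value-[a] a x) (trans (value-scale t Xᵠ x) (cong (t *_) (frobenius 0# 1#))))) ⟩
      (a + x * t) + - (a + t * (0# + x * 1#))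
        ≡⟨ solve 3 (λ a x t → (a :+ x :* t) :+ :- (a :+ t :* (:0 :+ x :* :1)) := :0) refl a x t ⟩
      0# ∎
      where
      open ≡-Reasoning
      open FSolver
      frobenius : ∀ a t → value ((a ∷ t ∷ []) ^ₚ q) x ≡ a + x * t
      frobenius a t = trans (value-^ₚ (a ∷ t ∷ []) q x) (trans (x^q≡x _) (value-[a,b] a t x))
    D≡0 : ∀ i → coeff D i ≡ 0#
    D≡0 = degree<N⇒0 q (allFin q) D (Unique.allFin⁺ q) (All.tabulate⁺ valueD)
      (ℕ.≤-reflexive (sym (List.length-tabulate {n = q} (λ i → i)))) high

  linear-^q-mod : ∀ a t → linear a t ^ₛ suc n ≋ constant a mod suc n
  linear-^q-mod a t k k<q = trans (linear-^q a t k) (trans (cong (constant a k +_)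
    (trans (constant-⊛ t (U ^ₛ suc n) k) (trans (cong (t *_) (U^-low (suc n) k k<q)) (zeroʳ t)))) (+-identityʳ _))

-- Euler's criterion

module OddField {h : ℕ} (F : FieldOn (suc (h ℕ.+ h))) (0<h : 0 < h) where
  open FieldOn F using (0#; 1#; _+_; _*_; -_; 0≢1)
  open FieldAlgebra F
  open Fermat F
  open CommutativeRing fieldRing
    using (*-identityʳ; +-identityˡ; zeroˡ; zeroʳ)
  open FSolver

  u²≡1 : ∀ u → u * u ≡ 1# → u ≡ 1# ⊎ u ≡ - 1#
  u²≡1 u e with u Fin.≟ 1#
  ... | yes u≡1 = inj₁ u≡1
  ... | no  u≢1 = inj₂ (-≡0 (trans (cong (u +_) (solve 0 (:- :- :1 := :1) refl)) (*-cancel-0 (-≢0 u≢1) (begin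
      (u + - 1#) * (u + 1#)   ≡⟨ solve 1 (λ u → (u :+ :- :1) :* (u :+ :1) := u :* u :+ :- :1) refl u ⟩
      u * u + - 1#            ≡⟨ ≡⇒-≡0 e ⟩
      0#                      ∎))))
    where open ≡-Reasoning

  ^h-sign : ∀ x → x ≢ 0# → x ^ h ≡ 1# ⊎ x ^ h ≡ - 1#
  ^h-sign x x≢0 = u²≡1 (x ^ h) (trans (sym (^-homo-* x h h)) (x≢0⇒x^[q-1]≡1 x x≢0))

  square-^h : ∀ t → t ≢ 0# → (t * t) ^ h ≡ 1#
  square-^h t t≢0 = trans (^-distrib-* t t h) (trans (sym (^-homo-* t h h)) (x≢0⇒x^[q-1]≡1 t t≢0))

  0^h≡0 : 0# ^ h ≡ 0#
  0^h≡0 = 0^ 0<h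
    where
    0^ : ∀ {m} → 0 < m → 0# ^ m ≡ 0#
    0^ (s≤s _) = zeroˡ _

  X^h-1 : Poly
  X^h-1 = (0# ∷ 1# ∷ []) ^ₚ h ⊟ (1# ∷ [])

  value-X^h-1 : ∀ x → value X^h-1 x ≡ x ^ h + - 1#
  value-X^h-1 x = trans (value-⊟ ((0# ∷ 1# ∷ []) ^ₚ h) _ x)
    (cong₂ (λ u v → u + - v) (trans (value-^ₚ (0# ∷ 1# ∷ []) h x)
        (cong (_^ h) (trans (value-[a,b] 0# 1# x) (solve 1 (λ x → :0 :+ x :* :1 := x) refl x)))) (value-[a] 1# x))

  length-X^h-1 : length X^h-1 ≤ suc h
  length-X^h-1 = length-⊟ ((0# ∷ 1# ∷ []) ^ₚ h) _ (ℕ.≤-trans (length-^ₚ {1} (0# ∷ 1# ∷ []) h ℕ.≤-refl)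
      (s≤s (ℕ.≤-reflexive (ℕ.*-identityʳ h)))) (s≤s z≤n)

  -1≢0 : - 1# ≢ 0#
  -1≢0 e = 0≢1 (trans (sym -0#≈0#) (trans (cong -_ (sym e)) (solve 0 (:- :- :1 := :1) refl)))

  -- Odd characteristic comes from odd order: if 1 = -1, then x^h = 1 for all 2h units, so X^h - 1,
  -- of degree only h, would be the zero polynomial, although its value at 0 is -1.
  1≢-1 : 1# ≢ - 1#
  1≢-1 1≡-1 = -1≢0 (trans (sym (+-identityˡ _)) (trans (cong (_+ - 1#) (sym 0^h≡0)) (trans (sym (value-X^h-1 0#))
    (coeff-0⇒value-0 X^h-1 0# (simpleRoots⇒0 units X^h-1 (Unique.tabulate⁺ (Fin.punchIn-injective 0# _ _))
      (All.tabulate⁺ (λ i → trans (value-X^h-1 (unit i)) (≡⇒-≡0 (one (^h-sign (unit i) (unit≢0 i))))))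
      (ℕ.≤-trans length-X^h-1 (ℕ.≤-trans (ℕ.+-monoˡ-≤ h 0<h) (ℕ.≤-reflexive (sym length-units)))))))))
    where
    one : ∀ {u} → u ≡ 1# ⊎ u ≡ - 1# → u ≡ 1#
    one (inj₁ e) = e
    one (inj₂ e) = trans e (sym 1≡-1)

  dilate : Poly → Poly
  dilate []      = []
  dilate (a ∷ p) = a ∷ 0# ∷ dilate p

  length-dilate : ∀ p → length (dilate p) ≡ length p ℕ.+ length p
  length-dilate []      = refl
  length-dilate (a ∷ p) = cong suc (trans (cong suc (length-dilate p)) (sym (ℕ.+-suc _ _)))

  value-dilate : ∀ p x → value (dilate p) x ≡ value p (x * x)
  value-dilate []      x = refl
  value-dilate (a ∷ p) x = trans (cong (λ w → a + x * (0# + x * w)) (value-dilate p x))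
    (solve 3 (λ a x w → a :+ x :* (:0 :+ x :* w) := a :+ (x :* x) :* w) refl a x _)

  -- Write X^h − 1 = (X − u) w. If u were not a square, w(X²) would vanish at all 2h units
  -- although its degree is below 2h.
  ^h≡1⇒square : ∀ u → u ^ h ≡ 1# → ∃[ t ] (t * t ≡ u)
  ^h≡1⇒square u u^h≡1 with Fin.any? (λ t → t * t Fin.≟ u)
  ... | yes root = root
  ... | no  none = ⊥-elim (-1≢0 (begin
    - 1#                         ≡⟨ sym (+-identityˡ _) ⟩
    0# + - 1#                    ≡⟨ cong (_+ - 1#) (sym 0^h≡0) ⟩
    0# ^ h + - 1#                ≡⟨ factor 0# ⟩
    (0# + - u) * value w 0#      ≡⟨ cong (λ y → (0# + - u) * value w y) (sym (zeroˡ 0#)) ⟩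
    (0# + - u) * value w (0# * 0#) ≡⟨ cong ((0# + - u) *_) (trans (sym (value-dilate w 0#))
        (coeff-0⇒value-0 (dilate w) 0# w≡0)) ⟩
    (0# + - u) * 0#              ≡⟨ zeroʳ _ ⟩
    0#                           ∎))
    where
    open ≡-Reasoning
    w : Poly
    w = quotient X^h-1 u
    factor : ∀ x → x ^ h + - 1# ≡ (x + - u) * value w x
    factor x = trans (sym (value-X^h-1 x)) (trans (eval-division fieldRing (λ x → x) _ X^h-1 u x)
      (trans (cong (_+ (x + - u) * value w x) (trans (value-X^h-1 u) (≡⇒-≡0 u^h≡1))) (+-identityˡ _)))
    length-w : length w ≤ h
    length-w = go X^h-1 length-X^h-1
      where
      go : ∀ p → length p ≤ suc h → length (quotient p u) ≤ h
      go []      _         = z≤n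
      go (c ∷ p) (s≤s p≤h) = ℕ.≤-trans (ℕ.≤-reflexive (length-quotient c p u)) p≤h
    w≡0 : ∀ i → coeff (dilate w) i ≡ 0#
    w≡0 = simpleRoots⇒0 units (dilate w) (Unique.tabulate⁺ (Fin.punchIn-injective 0# _ _))
      (All.tabulate⁺ (λ i → let x = unit i in trans (value-dilate w x) (*-cancel-0 (-≢0 (λ e → none (x , e)))
        (trans (sym (factor (x * x))) (≡⇒-≡0 (square-^h x (unit≢0 i)))))))
      (ℕ.≤-trans (ℕ.≤-reflexive (length-dilate w)) (ℕ.≤-trans (ℕ.+-mono-≤ length-w length-w)
          (ℕ.≤-reflexive (sym length-units))))

-- This lets two distinct indices produced by the pigeonhole principle be read as two coefficient
-- vectors that differ somewhere.
coordinates-≡⇒≡ : ∀ {m n} (x y : Fin (m ℕ.^ n)) → (∀ i → finToFun {m} {n} x i ≡ finToFun {m} {n} y i) → x ≡ y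
coordinates-≡⇒≡ {m} {n} x y e = begin
  x                              ≡⟨ Fin.funToFin-finToFin {n} {m} x ⟨
  funToFin (finToFun {m} {n} x)  ≡⟨ funToFin-cong e ⟩
  funToFin (finToFun {m} {n} y)  ≡⟨ Fin.funToFin-finToFin {n} {m} y ⟩
  y                              ∎
  where
  open ≡-Reasoning
  funToFin-cong : ∀ {n} {f g : Fin n → Fin m} → (∀ i → f i ≡ g i) → funToFin f ≡ funToFin g
  funToFin-cong {zero}  e = refl
  funToFin-cong {suc n} e = cong₂ combine (e fzero) (funToFin-cong (e ∘ fsuc))

-- The product f, its local expansion, and degrees of the coefficients

module Products {n : ℕ} (F : FieldOn (suc n)) where
  open FieldOn F using (0#; 1#; _+_; _*_; -_; 0≢1)
  open FieldAlgebra F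
  open Fermat F
  open CommutativeRing fieldRing using (*-assoc; *-identityʳ; +-identityˡ; zeroˡ; zeroʳ)

  q : ℕ
  q = suc n

  -- The polynomial f occurs in three forms: `φ` at a field element, `Φ` at a series, `f` as a list.
  -- The factors are y - X rather than X - y because y lies in the translate by x when y - x is a
  -- nonzero square.
  φ : List (Fin q) → Fin q → Fin q
  φ []       a = 1#
  φ (y ∷ ys) a = (y + - a) * φ ys a

  Φ : List (Fin q) → Series → Series
  Φ []       z = constant 1#
  Φ (y ∷ ys) z = (constant y ⊕ (S.- z)) ⊛ Φ ys z

  f : List (Fin q) → Poly
  f []       = 1# ∷ []
  f (y ∷ ys) = (y ∷ - 1# ∷ []) ⊠ f ys

  length-f : ∀ ys → length (f ys) ≤ suc (length ys)
  length-f []       = ℕ.≤-refl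
  length-f (y ∷ ys) = length-⊠ {1} (y ∷ - 1# ∷ []) (f ys) ℕ.≤-refl (length-f ys)

  value-f : ∀ ys a → value (f ys) a ≡ φ ys a
  value-f []       a = value-[a] 1# a
  value-f (y ∷ ys) a = trans (value-⊠ (y ∷ - 1# ∷ []) (f ys) a) (cong₂ _*_
    (trans (value-[a,b] y (- 1#) a) (FSolver.solve 2 (λ y a → y :+ a :* :- :1 := y :+ :- a) refl y a)) (value-f ys a))
    where open FSolver

  constant-- : ∀ a → constant (- a) ≋ S.- constant a
  constant-- a zero    = refl
  constant-- a (suc n) = sym -0#≈0#

  constant-* : ∀ a b → constant (a * b) ≋ constant a ⊛ constant b
  constant-* a b zero    = refl
  constant-* a b (suc n) = sym (trans (constant-⊛ a (constant b) (suc n)) (zeroʳ a))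

  constant-^ : ∀ a m → constant a ^ₛ m ≋ constant (a ^ m)
  constant-^ a zero    = S.refl
  constant-^ a (suc m) = S.trans (S.*-congˡ {constant a} (constant-^ a m)) (S.sym (constant-* a (a ^ m)))

  eval-f : ∀ ys z → eval (f ys) z ≋ Φ ys z
  eval-f []       z = eval-[a] 1# z
  eval-f (y ∷ ys) z = S.trans (eval-⊠ (y ∷ - 1# ∷ []) (f ys) z) (S.*-cong
    (S.trans (eval-[a,b] y (- 1#) z) (S.+-congˡ {constant y} (S.trans (S.*-congˡ {z} (constant-- 1#))
        (solve 1 (λ z → z :* :- :1 := :- z) S.refl z)))) (eval-f ys z))
    where open SSolver

  Φ-cong : ∀ ys {z z′} → z ≋ z′ → Φ ys z ≋ Φ ys z′
  Φ-cong []       e = S.refl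
  Φ-cong (y ∷ ys) e = S.*-cong (S.+-congˡ {constant y} (S.-‿cong e)) (Φ-cong ys e)

  constant-linear : ∀ y a t → constant y ⊕ (S.- linear a t) ≋ linear (y + - a) (- t)
  constant-linear y a t zero    = refl
  constant-linear y a t (suc k) = trans (+-identityˡ _) (sym (constant-- t k))

  linear-cong : ∀ {a b s t} → a ≡ b → s ≡ t → linear a s ≋ linear b t
  linear-cong refl refl _ = refl

  Φ-at-0 : ∀ ys a t → Φ ys (linear a t) 0 ≡ φ ys a
  Φ-at-0 []       a t = refl
  Φ-at-0 (y ∷ ys) a t = cong ((y + - a) *_) (Φ-at-0 ys a t)

  φ-root : ∀ {x} ys → All (λ y → y ≢ x) ys → φ ys x ≢ 0#
  φ-root []       _          = 0≢1 ∘ sym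
  φ-root (y ∷ ys) (y≢x ∷ ne) = *-≢0 (-≢0 y≢x) (φ-root ys ne)

  -- The q-th power is known for linear series only, so the product is treated factor by factor.
  Φ-^q : ∀ ys a t → Φ ys (linear a t) ^ₛ q ≋ constant (φ ys a) mod q
  Φ-^q []       a t k k<q = trans (constant-^ 1# q k) (cong (λ w → constant w k) (x^q≡x 1#))
  Φ-^q (y ∷ ys) a t k k<q = begin
    (((constant y ⊕ (S.- linear a t)) ⊛ Φ ys (linear a t)) ^ₛ q) k
      ≡⟨ Exp.^-distrib-* (constant y ⊕ (S.- linear a t)) (Φ ys (linear a t)) q k ⟩
    ((constant y ⊕ (S.- linear a t)) ^ₛ q ⊛ Φ ys (linear a t) ^ₛ q) k
      ≡⟨ ⊛-cong-mod {q} (λ k k<q → trans (Exp.^-congˡ q (constant-linear y a t) k) (linear-^q-mod (y + - a) (- t) k k<q))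
          (Φ-^q ys a t) k k<q ⟩
    (constant (y + - a) ⊛ constant (φ ys a)) k
      ≡⟨ constant-* (y + - a) (φ ys a) k ⟨
    constant (φ (y ∷ ys) a) k
      ∎
    where open ≡-Reasoning

  -- y − (a + φ(a) U) = (y − a)(1 − φ(a)/(y − a) U), and the cofactor φ(a)/(y − a) is again a product;
  -- m accumulates the factors already passed.
  G : Fin q → Fin q → List (Fin q) → Series
  G a m []       = constant 1#
  G a m (y ∷ ys) = linear 1# (- (m * φ ys a)) ⊛ G a (m * (y + - a)) ys

  -- The slope m φ(a) is an invariant of the recursion: passing a factor moves y - a out of `φ` and
  -- into m. Starting with m = 1 keeps it equal to f(a).
  Φ-factor : ∀ a m ys → Φ ys (linear a (m * φ ys a)) ≋ constant (φ ys a) ⊛ G a m ys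
  Φ-factor a m []       = S.sym (⊛-identityˡ (constant 1#))
  Φ-factor a m (y ∷ ys) = begin
    (constant y ⊕ (S.- linear a t)) ⊛ Φ ys (linear a t)
      ≈⟨ S.*-cong {constant y ⊕ (S.- linear a t)} {linear (y + - a) (- t)} (constant-linear y a t)
          (Φ-cong ys (linear-cong {a} refl (sym (*-assoc m (y + - a) (φ ys a))))) ⟩
    linear (y + - a) (- t) ⊛ Φ ys (linear a (m * (y + - a) * φ ys a))
      ≈⟨ S.*-cong {linear (y + - a) (- t)} {constant (y + - a) ⊛ linear 1# (- (m * φ ys a))} lin≋
          (Φ-factor a (m * (y + - a)) ys) ⟩
    (constant (y + - a) ⊛ linear 1# (- (m * φ ys a))) ⊛ (constant (φ ys a) ⊛ G a (m * (y + - a)) ys)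
      ≈⟨ solve 4 (λ a b c d → (a :* b) :* (c :* d) := (a :* c) :* (b :* d)) S.refl (constant (y + - a))
          (linear 1# (- (m * φ ys a))) (constant (φ ys a)) (G a (m * (y + - a)) ys) ⟩
    (constant (y + - a) ⊛ constant (φ ys a)) ⊛ G a m (y ∷ ys)
      ≈⟨ S.*-congʳ {G a m (y ∷ ys)} (constant-* (y + - a) (φ ys a)) ⟨
    constant (φ (y ∷ ys) a) ⊛ G a m (y ∷ ys)
      ∎
    where
    open SSolver
    open import Relation.Binary.Reasoning.Setoid S.setoid
    t : Fin q
    t = m * φ (y ∷ ys) a
    lin≋ : linear (y + - a) (- t) ≋ constant (y + - a) ⊛ linear 1# (- (m * φ ys a))
    lin≋ zero    = sym (*-identityʳ _)
    lin≋ (suc k) = sym (trans (constant-⊛ (y + - a) (linear 1# (- (m * φ ys a))) (suc k))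
      (trans (sym (constant-⊛ (y + - a) (constant (- (m * φ ys a))) k))
      (trans (sym (constant-* (y + - a) (- (m * φ ys a)) k))
        (constant-cong (FSolver.solve 3 (λ d m p → d FSolver.:* FSolver.:- (m FSolver.:* p) FSolver.:= FSolver.:-
            (m FSolver.:* (d FSolver.:* p))) refl (y + - a) m (φ ys a)) k))))

  -- The list is kept as data, since a function on a finite field comes from many polynomials and
  -- the pigeonhole argument compares the coefficients of one chosen list.
  Degree≤ : ℕ → (Fin q → Fin q) → Set
  Degree≤ N g = ∃[ p ] (length p ≤ suc N × (∀ a → g a ≡ value p a))

  degree-weaken : ∀ {M N g} → M ≤ N → Degree≤ M g → Degree≤ N g
  degree-weaken M≤N (p , p≤ , e) = p , ℕ.≤-trans p≤ (s≤s M≤N) , e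

  degree-cong : ∀ {N g g′} → (∀ a → g a ≡ g′ a) → Degree≤ N g → Degree≤ N g′
  degree-cong g≡g′ (p , p≤ , e) = p , p≤ , λ a → trans (sym (g≡g′ a)) (e a)

  degree-+ : ∀ {N g g′} → Degree≤ N g → Degree≤ N g′ → Degree≤ N (λ a → g a + g′ a)
  degree-+ (p , p≤ , e) (p′ , p′≤ , e′) = p ⊞ p′ , length-⊞ p p′ p≤ p′≤ , λ a → trans (cong₂ _+_ (e a) (e′ a))
      (sym (value-⊞ p p′ a))

  degree-* : ∀ {M N g g′} → Degree≤ M g → Degree≤ N g′ → Degree≤ (M ℕ.+ N) (λ a → g a * g′ a)
  degree-* (p , p≤ , e) (p′ , p′≤ , e′) = p ⊠ p′ , length-⊠ p p′ p≤ p′≤ , λ a → trans (cong₂ _*_ (e a) (e′ a))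
      (sym (value-⊠ p p′ a))

  degree-const : ∀ c → Degree≤ 0 (λ _ → c)
  degree-const c = c ∷ [] , ℕ.≤-refl , λ a → sym (value-[a] c a)

  degree-linear : ∀ c d → Degree≤ 1 (λ a → c + a * d)
  degree-linear c d = c ∷ d ∷ [] , ℕ.≤-refl , λ a → sym (value-[a,b] c d a)

  degree-φ : ∀ ys → Degree≤ (length ys) (φ ys)
  degree-φ ys = f ys , length-f ys , λ a → sym (value-f ys a)

  degree-minus : ∀ c → Degree≤ 1 (λ a → c + - a)
  degree-minus c = degree-cong (λ a → solve 2 (λ c a → c :+ a :* :- :1 := c :+ :- a) refl c a) (degree-linear c (- 1#))
    where open FSolver

  -- The coefficient of U^k may have degree D + k e in a. With the rate e fixed, such families are
  -- closed under products, the offsets D being added.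
  Filtered : ℕ → ℕ → (Fin q → Series) → Set
  Filtered e D W = ∀ k → Degree≤ (D ℕ.+ k ℕ.* e) (λ a → W a k)

  filtered-⊕ : ∀ {e D W W′} → Filtered e D W → Filtered e D W′ → Filtered e D (λ a → W a ⊕ W′ a)
  filtered-⊕ w w′ k = degree-+ (w k) (w′ k)

  filtered-weaken : ∀ {e D E W} → D ≤ E → Filtered e D W → Filtered e E W
  filtered-weaken {e} D≤E w k = degree-weaken (ℕ.+-monoˡ-≤ (k ℕ.* e) D≤E) (w k)

  filtered-⊛ : ∀ {e D E W W′} → Filtered e D W → Filtered e E W′ → Filtered e (D ℕ.+ E) (λ a → W a ⊛ W′ a)
  filtered-⊛ {e} {D} {E} w w′ zero    = degree-weaken (ℕ.≤-reflexive (lemma D E)) (degree-* (w 0) (w′ 0))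
    where
    lemma : ∀ D E → D ℕ.+ 0 ℕ.+ (E ℕ.+ 0) ≡ D ℕ.+ E ℕ.+ 0
    lemma = solve-∀
  filtered-⊛ {e} {D} {E} {W} {W′} w w′ (suc k) = degree-+
    (degree-weaken (ℕ.≤-reflexive (lemma D E (suc k ℕ.* e))) (degree-* (w 0) (w′ (suc k))))
    (degree-weaken (ℕ.≤-reflexive (lemma′ D E e (k ℕ.* e))) (filtered-⊛ {e} {D ℕ.+ e} {E} {λ a → tail (W a)} {W′}
      (λ j → degree-weaken (ℕ.≤-reflexive (sym (ℕ.+-assoc D e (j ℕ.* e)))) (w (suc j))) w′ k))
    where
    lemma : ∀ D E m → D ℕ.+ 0 ℕ.+ (E ℕ.+ m) ≡ D ℕ.+ E ℕ.+ m
    lemma = solve-∀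
    lemma′ : ∀ D E e m → D ℕ.+ e ℕ.+ E ℕ.+ m ≡ D ℕ.+ E ℕ.+ (e ℕ.+ m)
    lemma′ = solve-∀

  filtered-constant : ∀ {e D g} → Degree≤ D g → Filtered e D (λ a → constant (g a))
  filtered-constant {e} {D} d zero    = degree-weaken (ℕ.m≤m+n D 0) d
  filtered-constant d (suc k) = degree-weaken z≤n (degree-const 0#)

  filtered-linear : ∀ {e D g g′} → Degree≤ D g → Degree≤ (D ℕ.+ e) g′ → Filtered e D (λ a → linear (g a) (g′ a))
  filtered-linear {e} {D} d d′ zero          = degree-weaken (ℕ.m≤m+n D 0) d
  filtered-linear {e} {D} d d′ (suc zero)    = degree-weaken (ℕ.+-monoʳ-≤ D (ℕ.m≤m+n e 0)) d′
  filtered-linear d d′ (suc (suc k)) = degree-weaken z≤n (degree-const 0#)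

  -- Offset 0 survives any power, so the exponent h costs no degree at all. This is the gain from
  -- splitting off f(a): the cofactor `G` has constant term 1 and hence offset 0.
  filtered-^ : ∀ {e W} m → Filtered e 0 W → Filtered e 0 (λ a → W a ^ₛ m)
  filtered-^ zero    w = filtered-constant (degree-const 1#)
  filtered-^ (suc m) w = filtered-⊛ w (filtered-^ m w)

  -- Each step moves one degree from the remaining list to m, so δ plus the length is preserved.
  filtered-G : ∀ {e δ m} ys → Degree≤ δ m → δ ℕ.+ length ys ≤ e → Filtered e 0 (λ a → G a (m a) ys)
  filtered-G []       d _ = filtered-constant (degree-const 1#)
  filtered-G {e} {δ} {m} (y ∷ ys) d δ+|ys|≤e = filtered-⊛
    (filtered-linear (degree-const 1#) (degree-weaken (ℕ.≤-trans (ℕ.+-monoʳ-≤ δ (ℕ.n≤1+n _)) δ+|ys|≤e)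
      (degree-cong (λ a → solve 1 (λ x → (:- :1) :* x := :- x) refl (m a * φ ys a))
          (degree-* (degree-const (- 1#)) (degree-* d (degree-φ ys))))))
    (filtered-G ys (degree-* d (degree-minus y)) (ℕ.≤-trans (ℕ.≤-reflexive (ℕ.+-assoc δ 1 (length ys))) δ+|ys|≤e))
    where open FSolver

  filtered-eval : ∀ {e} r {Z} → Filtered e 1 Z → Filtered e (length r) (λ a → eval r (Z a))
  filtered-eval []      z k = degree-weaken z≤n (degree-const 0#)
  filtered-eval (b ∷ r) z = filtered-⊕ (filtered-weaken z≤n (filtered-constant (degree-const b)))
      (filtered-⊛ z (filtered-eval r z))

  U^-cancel : ∀ m {v w} → U ^ₛ m ⊛ v ≋ U ^ₛ m ⊛ w → v ≋ w
  U^-cancel zero    {v} {w} e = S.trans (S.sym (⊛-identityˡ v)) (S.trans e (⊛-identityˡ w))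
  U^-cancel (suc m) {v} {w} e = U^-cancel m (U-cancel (S.trans (S.sym (S.*-assoc U (U ^ₛ m) v))
      (S.trans e (S.*-assoc U (U ^ₛ m) w))))

  -- The order of vanishing of the left side is odd and that of the right side even.
  odd-even-order : ∀ k ρ σ η κ → η 0 ≢ 0# → κ 0 ≢ 0# → U ⊛ ((ρ ⊛ ρ) ⊛ η) ≋ (σ ⊛ σ) ⊛ κ → ρ k ≡ 0# × σ k ≡ 0#
  odd-even-order k ρ σ η κ η≢0 κ≢0 e = at k
    where
    open SSolver
    square-0 : ∀ {x y} → y ≢ 0# → (x * x) * y ≡ 0# → x ≡ 0#
    square-0 {x} {y} y≢0 e with x Fin.≟ 0#
    ... | yes x≡0 = x≡0
    ... | no  x≢0 = ⊥-elim (*-≢0 (*-≢0 x≢0 x≢0) y≢0 e)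
    σ≡0 : σ 0 ≡ 0#
    σ≡0 = square-0 κ≢0 (trans (sym (e 0)) (zeroˡ _))
    e₁ : (ρ ⊛ ρ) ⊛ η ≋ U ⊛ ((tail σ ⊛ tail σ) ⊛ κ)
    e₁ = U-cancel (S.trans e (S.trans (S.*-congʳ {κ} (S.*-cong (U⊛tail σ σ≡0) (U⊛tail σ σ≡0)))
      (solve 3 (λ u s k → ((u :* s) :* (u :* s)) :* k := u :* (u :* ((s :* s) :* k))) S.refl U (tail σ) κ)))
    ρ≡0 : ρ 0 ≡ 0#
    ρ≡0 = square-0 η≢0 (trans (e₁ 0) (zeroˡ _))
    e₂ : U ⊛ ((tail ρ ⊛ tail ρ) ⊛ η) ≋ (tail σ ⊛ tail σ) ⊛ κ
    e₂ = U-cancel (S.trans (S.sym (S.trans (S.*-congʳ {η} (S.*-cong (U⊛tail ρ ρ≡0) (U⊛tail ρ ρ≡0)))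
      (solve 3 (λ u s k → ((u :* s) :* (u :* s)) :* k := u :* (u :* ((s :* s) :* k))) S.refl U (tail ρ) η))) e₁)
    at : ∀ k → ρ k ≡ 0# × σ k ≡ 0#
    at zero    = ρ≡0 , σ≡0
    at (suc k) = odd-even-order k (tail ρ) (tail σ) η κ η≢0 κ≢0 e₂

-- Stepanov's method: independence, local expansion, zero count

module Stepanov {h : ℕ} (F : FieldOn (suc (h ℕ.+ h))) (0<h : 0 < h)
  (y₁ : Fin (suc (h ℕ.+ h))) (ys′ : List (Fin (suc (h ℕ.+ h)))) (unique : Unique (y₁ ∷ ys′))
  (c : Fin (suc (h ℕ.+ h))) (φ[c]≢0 : Products.φ F (y₁ ∷ ys′) c ≢ FieldOn.0# F) where

  open FieldOn F using (0#; 1#; _+_; _*_; -_; 0≢1)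
  open FieldAlgebra F
  open Fermat F
  open Products F
  open OddField F 0<h using (0^h≡0)
  open CommutativeRing fieldRing using (*-identityˡ; +-identityˡ; +-identityʳ; -‿inverseʳ)

  ys : List (Fin q)
  ys = y₁ ∷ ys′

  d : ℕ
  d = length ys

  g Q : Poly
  g = f ys ^ₚ h
  Q = (0# ∷ 1# ∷ []) ^ₚ q ⊟ (c ∷ [])

  -- The sum over j in Horner form with base `Q`, so that induction on J strips off the block that
  -- survives modulo (X - c)^q.
  auxiliary : ∀ J → (Fin J → Poly × Poly) → Poly
  auxiliary zero    w = []
  auxiliary (suc J) w = (proj₁ (w fzero) ⊞ proj₂ (w fzero) ⊠ g) ⊞ Q ⊠ auxiliary J (w ∘ fsuc)

  eval-g : ∀ z → eval g z ≋ Φ ys z ^ₛ h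
  eval-g z = S.trans (eval-^ₚ (f ys) h z) (Exp.^-congˡ h (eval-f ys z))

  eval-Q : ∀ z → eval Q z ≋ z ^ₛ q ⊕ (S.- constant c)
  eval-Q z = S.trans (eval-⊟ ((0# ∷ 1# ∷ []) ^ₚ q) (c ∷ []) z) (S.+-cong
    (S.trans (eval-^ₚ (0# ∷ 1# ∷ []) q z) (Exp.^-congˡ q evalX)) (S.-‿cong (eval-[a] c z)))
    where
    open SSolver
    evalX : eval (0# ∷ 1# ∷ []) z ≋ z
    evalX = S.trans (eval-[a,b] 0# 1# z) (S.trans (S.+-congʳ constant-0) (solve 1 (λ z → :0 :+ z :* :1 := z) S.refl z))

  eval-auxiliary : ∀ J w z → eval (auxiliary (suc J) w) z ≋
    (eval (proj₁ (w fzero)) z ⊕ eval (proj₂ (w fzero)) z ⊛ Φ ys z ^ₛ h) ⊕ (z ^ₛ q ⊕ (S.- constant c)) ⊛ eval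
        (auxiliary J (w ∘ fsuc)) z
  eval-auxiliary J w z = S.trans (eval-⊞ (r ⊞ s ⊠ g) (Q ⊠ rest) z) (S.+-cong
    (S.trans (eval-⊞ r (s ⊠ g) z) (S.+-congˡ {eval r z} (S.trans (eval-⊠ s g z) (S.*-congˡ {eval s z} (eval-g z)))))
    (S.trans (eval-⊠ Q rest z) (S.*-congʳ {eval rest z} (eval-Q z))))
    where
    r = proj₁ (w fzero)
    s = proj₂ (w fzero)
    rest = auxiliary J (w ∘ fsuc)

  Short : ∀ {J} → ℕ → (Fin J → Poly × Poly) → Set
  Short N w = ∀ j → length (proj₁ (w j)) ≤ N × length (proj₂ (w j)) ≤ N

  length-auxiliary : ∀ {D} J w → Short D w → length (auxiliary J w) ≤ suc (D ℕ.+ h ℕ.* d ℕ.+ J ℕ.* q)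
  length-auxiliary zero    w short = z≤n
  length-auxiliary {D} (suc J) w short with r≤ , s≤ ← short fzero = length-⊞ (r ⊞ s ⊠ g) (Q ⊠ rest)
    (ℕ.≤-trans (length-⊞ r (s ⊠ g) (ℕ.≤-trans r≤ (ℕ.≤-trans (ℕ.m≤m+n D (h ℕ.* d)) (ℕ.n≤1+n _)))
      (length-⊠ s g (ℕ.m≤n⇒m≤1+n s≤) (length-^ₚ (f ys) h (length-f ys)))) (s≤s (ℕ.m≤m+n _ _)))
    (ℕ.≤-trans (length-⊠ {q} Q rest length-Q (length-auxiliary J (w ∘ fsuc) (short ∘ fsuc)))
        (s≤s (ℕ.≤-reflexive (lemma (D ℕ.+ h ℕ.* d) q (J ℕ.* q)))))
    where
    r = proj₁ (w fzero)
    s = proj₂ (w fzero)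
    rest = auxiliary J (w ∘ fsuc)
    length-Q : length Q ≤ suc q
    length-Q = length-⊟ ((0# ∷ 1# ∷ []) ^ₚ q) (c ∷ []) (ℕ.≤-trans (length-^ₚ {1} (0# ∷ 1# ∷ []) q ℕ.≤-refl)
        (s≤s (ℕ.≤-reflexive (ℕ.*-identityʳ q)))) (s≤s z≤n)
    lemma : ∀ x y z → y ℕ.+ (x ℕ.+ z) ≡ x ℕ.+ (y ℕ.+ z)
    lemma = solve-∀

  z₀ : Series
  z₀ = linear c 1#

  eval-≡0 : ∀ p a → eval p (linear a 1#) ≋ 0ₛ → ∀ i → coeff p i ≡ 0#
  eval-≡0 p a e = highRoots⇒0 (length p) (a ∷ []) p ([] ∷ []) ((1# , 0≢1 ∘ sym , λ k _ → e k) ∷ []) (ℕ.m≤m+n (length p) 0)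

  -- Squaring and multiplying by f gives r² f ≡ f(c) s² modulo (X − c)^q, an equality for degree reasons;
  -- this is impossible for nonzero r, s because y₁ is a simple root of f.
  pair-≡0 : ∀ {D₀} r s → D₀ ℕ.+ D₀ ℕ.+ d ≤ h ℕ.+ h → length r ≤ suc D₀ → length s ≤ suc D₀ →
            eval r z₀ ⊕ eval s z₀ ⊛ Φ ys z₀ ^ₛ h ≋ 0ₛ mod q → (∀ i → coeff r i ≡ 0#) × (∀ i → coeff s i ≡ 0#)
  pair-≡0 {D₀} r s D≤ r≤ s≤ e = eval-≡0 r y₁ (λ k → proj₁ (vanish k)) , eval-≡0 s y₁ (λ k → proj₂ (vanish k))
    where
    open SSolver
    κ : Fin q
    κ = φ ys c
    E : Poly
    E = (r ⊠ r) ⊠ f ys ⊟ scale κ (s ⊠ s)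
    eval-E : ∀ z → eval E z ≋ (eval r z ⊛ eval r z) ⊛ Φ ys z ⊕ (S.- (constant κ ⊛ (eval s z ⊛ eval s z)))
    eval-E z = S.trans (eval-⊟ ((r ⊠ r) ⊠ f ys) (scale κ (s ⊠ s)) z) (S.+-cong
      (S.trans (eval-⊠ (r ⊠ r) (f ys) z) (S.*-cong {eval (r ⊠ r) z} (eval-⊠ r r z) (eval-f ys z)))
      (S.-‿cong (S.trans (eval-scale κ (s ⊠ s) z) (S.*-congˡ {constant κ} (eval-⊠ s s z)))))
    r₀ = eval r z₀
    s₀ = eval s z₀
    f₀ = Φ ys z₀
    r₀≋ : r₀ ≋ S.- (s₀ ⊛ f₀ ^ₛ h) mod q
    r₀≋ k k<q = -≡0 (trans (cong (r₀ k +_) (neg-neg ((s₀ ⊛ f₀ ^ₛ h) k))) (e k k<q))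
      where
      neg-neg : ∀ x → - (- x) ≡ x
      neg-neg x = FSolver.solve 1 (λ x → FSolver.:- FSolver.:- x FSolver.:= x) refl x
    root : eval E z₀ ≋ 0ₛ mod q
    root k k<q = trans (eval-E z₀ k) (≡⇒-≡0 (begin
      ((r₀ ⊛ r₀) ⊛ f₀) k
        ≡⟨ ⊛-cong-mod {q} {r₀ ⊛ r₀} {_} {f₀} (⊛-cong-mod {q} {r₀} {_} {r₀} r₀≋ r₀≋) (λ _ _ → refl) k k<q ⟩
      (((S.- (s₀ ⊛ f₀ ^ₛ h)) ⊛ (S.- (s₀ ⊛ f₀ ^ₛ h))) ⊛ f₀) k
        ≡⟨ solve 3 (λ s g f → ((:- (s :* g)) :* (:- (s :* g))) :* f := (f :* (g :* g)) :* (s :* s)) S.refl s₀ (f₀ ^ₛ h) f₀ k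
            ⟩
      ((f₀ ⊛ (f₀ ^ₛ h ⊛ f₀ ^ₛ h)) ⊛ (s₀ ⊛ s₀)) k
        ≡⟨ S.*-congʳ {s₀ ⊛ s₀} (S.*-congˡ {f₀} (S.sym (Exp.^-homo-* f₀ h h))) k ⟩
      (f₀ ^ₛ q ⊛ (s₀ ⊛ s₀)) k
        ≡⟨ ⊛-cong-mod {q} {f₀ ^ₛ q} {_} {s₀ ⊛ s₀} (Φ-^q ys c 1#) (λ _ _ → refl) k k<q ⟩
      (constant κ ⊛ (s₀ ⊛ s₀)) k ∎))
      where open ≡-Reasoning
    length-E : length E ≤ q
    length-E = ℕ.≤-trans (length-⊟ ((r ⊠ r) ⊠ f ys) (scale κ (s ⊠ s))
      (length-⊠ (r ⊠ r) (f ys) (length-⊠ r r r≤ r≤) (length-f ys))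
      (length-scale κ (s ⊠ s) (ℕ.≤-trans (length-⊠ s s s≤ s≤) (s≤s (ℕ.m≤m+n _ d))))) (s≤s D≤)
    E≡0 : ∀ i → coeff E i ≡ 0#
    E≡0 = highRoots⇒0 q (c ∷ []) E ([] ∷ []) ((1# , 0≢1 ∘ sym , root) ∷ []) (ℕ.≤-trans length-E (ℕ.m≤m+n q 0))
    z₁ η r₁ s₁ : Series
    z₁ = linear y₁ 1#
    η = S.- Φ ys′ z₁
    r₁ = eval r z₁
    s₁ = eval s z₁
    φ′≢0 : φ ys′ y₁ ≢ 0#
    φ′≢0 = φ-root ys′ (All.map (λ y₁≢y e → y₁≢y (sym e)) (AllPairs.head unique))
    η≢0 : η 0 ≢ 0#
    η≢0 e = φ′≢0 (trans (sym (Φ-at-0 ys′ y₁ 1#)) (-‿injective (trans e (sym -0#≈0#))))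
    y₁-z₁ : constant y₁ ⊕ (S.- z₁) ≋ S.- U
    y₁-z₁ zero    = trans (-‿inverseʳ y₁) (sym -0#≈0#)
    y₁-z₁ (suc k) = +-identityˡ _
    eq : U ⊛ ((r₁ ⊛ r₁) ⊛ η) ≋ (s₁ ⊛ s₁) ⊛ constant κ
    eq k = -≡0 (trans (cong₂ (λ u v → u + - v)
      (trans (solve 3 (λ u r p → u :* (r :* :- p) := r :* ((:- u) :* p)) S.refl U (r₁ ⊛ r₁) (Φ ys′ z₁) k)
        (S.*-congˡ {r₁ ⊛ r₁} (S.*-congʳ {Φ ys′ z₁} (S.sym y₁-z₁)) k)) (S.*-comm (s₁ ⊛ s₁) (constant κ) k))
      (trans (sym (eval-E z₁ k)) (eval-coeff-0 E z₁ E≡0 k)))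
    vanish : ∀ k → r₁ k ≡ 0# × s₁ k ≡ 0#
    vanish k = odd-even-order k r₁ s₁ η (constant κ) η≢0 φ[c]≢0 eq

  coeff-⊟ : ∀ p p′ → (∀ i → coeff (p ⊟ p′) i ≡ 0#) → ∀ i → coeff p i ≡ coeff p′ i
  coeff-⊟ p p′ e i = -≡0 (begin
    coeff p i + - coeff p′ i          ≡⟨ cong₂ (λ u v → u + - v) (coeff≡eval p i) (coeff≡eval p′ i) ⟩
    eval p U i + - eval p′ U i        ≡⟨ eval-⊟ p p′ U i ⟨
    eval (p ⊟ p′) U i                 ≡⟨ coeff≡eval (p ⊟ p′) i ⟨
    coeff (p ⊟ p′) i                  ≡⟨ e i ⟩
    0#                                ∎)
    where open ≡-Reasoning

  _≈ₚ_ : Poly → Poly → Set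
  p ≈ₚ p′ = ∀ i → coeff p i ≡ coeff p′ i

  -- At c + U the base `Q` becomes U^q. Modulo U^q only the first pair is left, and `pair-≡0`
  -- applied to the difference of the two first pairs identifies them. After subtracting them, the
  -- factor U^q cancels, and the same argument applies to the remaining pairs.
  auxiliary-injective : ∀ {D₀} → D₀ ℕ.+ D₀ ℕ.+ d ≤ h ℕ.+ h → ∀ J w w′ → Short (suc D₀) w → Short (suc D₀) w′ →
    eval (auxiliary J w) z₀ ≋ eval (auxiliary J w′) z₀ →
    ∀ j → proj₁ (w j) ≈ₚ proj₁ (w′ j) × proj₂ (w j) ≈ₚ proj₂ (w′ j)
  auxiliary-injective {D₀} D≤ (suc J) w w′ short short′ e = λ { fzero → r≈ , s≈ ; (fsuc j) → rest j }
    where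
    open SSolver
    r = proj₁ (w fzero)
    s = proj₂ (w fzero)
    r′ = proj₁ (w′ fzero)
    s′ = proj₂ (w′ fzero)
    G₀ = Φ ys z₀ ^ₛ h
    Q₀ = z₀ ^ₛ q ⊕ (S.- constant c)
    A  = eval (auxiliary J (w ∘ fsuc)) z₀
    A′ = eval (auxiliary J (w′ ∘ fsuc)) z₀
    e₁ : (eval r z₀ ⊕ eval s z₀ ⊛ G₀) ⊕ Q₀ ⊛ A ≋ (eval r′ z₀ ⊕ eval s′ z₀ ⊛ G₀) ⊕ Q₀ ⊛ A′
    e₁ = S.trans (S.sym (eval-auxiliary J w z₀)) (S.trans e (eval-auxiliary J w′ z₀))
    Q₀-low : Q₀ ≋ 0ₛ mod q
    Q₀-low k k<q = ≡⇒-≡0 (linear-^q-mod c 1# k k<q)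
    Q₀-A : ∀ A → Q₀ ⊛ A ≋ 0ₛ mod q
    Q₀-A A k k<q = trans (⊛-cong-mod {q} {Q₀} {0ₛ} {A} Q₀-low (λ _ _ → refl) k k<q) (⊛-zeroˡ A k)
    low : eval (r ⊟ r′) z₀ ⊕ eval (s ⊟ s′) z₀ ⊛ G₀ ≋ 0ₛ mod q
    low k k<q = begin
      (eval (r ⊟ r′) z₀ ⊕ eval (s ⊟ s′) z₀ ⊛ G₀) k
        ≡⟨ S.+-cong (eval-⊟ r r′ z₀) (S.*-congʳ {G₀} (eval-⊟ s s′ z₀)) k ⟩
      ((eval r z₀ ⊕ (S.- eval r′ z₀)) ⊕ (eval s z₀ ⊕ (S.- eval s′ z₀)) ⊛ G₀) k
        ≡⟨ solve 5 (λ r r′ s s′ g → (r :+ :- r′) :+ (s :+ :- s′) :* g := (r :+ s :* g) :+ :- (r′ :+ s′ :* g)) S.refl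
             (eval r z₀) (eval r′ z₀) (eval s z₀) (eval s′ z₀) G₀ k ⟩
      (eval r z₀ ⊕ eval s z₀ ⊛ G₀) k + - (eval r′ z₀ ⊕ eval s′ z₀ ⊛ G₀) k
        ≡⟨ ≡⇒-≡0 (trans (sym (trans (cong ((eval r z₀ ⊕ eval s z₀ ⊛ G₀) k +_) (Q₀-A A k k<q)) (+-identityʳ _)))
             (trans (e₁ k) (trans (cong ((eval r′ z₀ ⊕ eval s′ z₀ ⊛ G₀) k +_) (Q₀-A A′ k k<q)) (+-identityʳ _)))) ⟩
      0# ∎
      where open ≡-Reasoning
    both : (∀ i → coeff (r ⊟ r′) i ≡ 0#) × (∀ i → coeff (s ⊟ s′) i ≡ 0#)
    both = pair-≡0 (r ⊟ r′) (s ⊟ s′) D≤ (length-⊟ r r′ (proj₁ (short fzero)) (proj₁ (short′ fzero)))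
      (length-⊟ s s′ (proj₂ (short fzero)) (proj₂ (short′ fzero))) low
    r≈ : r ≈ₚ r′
    r≈ = coeff-⊟ r r′ (proj₁ both)
    s≈ : s ≈ₚ s′
    s≈ = coeff-⊟ s s′ (proj₂ both)
    cancel : ∀ {u u′ v v′} → u ≡ u′ → u + v ≡ u′ + v′ → v ≡ v′
    cancel {u} {v = v} {v′} refl e = begin
      v               ≡⟨ FSolver.solve 2 (λ u v → v FSolver.:= (u FSolver.:+ v) FSolver.:+ FSolver.:- u) refl u v ⟩
      (u + v) + - u   ≡⟨ cong (_+ - u) e ⟩
      (u + v′) + - u  ≡⟨ FSolver.solve 2 (λ u v → v FSolver.:= (u FSolver.:+ v) FSolver.:+ FSolver.:- u) refl u v′ ⟨
      v′              ∎
      where open ≡-Reasoning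
    Q₀≋U^q : Q₀ ≋ U ^ₛ q
    Q₀≋U^q = S.trans (S.+-congʳ {S.- constant c} (linear-^q c 1#))
      (solve 2 (λ c u → (c :+ :1 :* u) :+ :- c := u) S.refl (constant c) (U ^ₛ q))
    QA≋QA′ : Q₀ ⊛ A ≋ Q₀ ⊛ A′
    QA≋QA′ k = cancel (S.+-cong (eval-coeff r r′ z₀ r≈) (S.*-congʳ {G₀} (eval-coeff s s′ z₀ s≈)) k) (e₁ k)
    A≋A′ : A ≋ A′
    A≋A′ = U^-cancel q (S.trans (S.*-congʳ {A} (S.sym Q₀≋U^q)) (S.trans QA≋QA′ (S.*-congʳ {A′} Q₀≋U^q)))
    rest : ∀ j → proj₁ (w (fsuc j)) ≈ₚ proj₁ (w′ (fsuc j)) × proj₂ (w (fsuc j)) ≈ₚ proj₂ (w′ (fsuc j))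
    rest = auxiliary-injective D≤ J (w ∘ fsuc) (w′ ∘ fsuc) (short ∘ fsuc) (short′ ∘ fsuc) A≋A′

  -- Modulo U^q, the auxiliary polynomial at a + φ(a) U, where φ(a)^h = ε.
  local : Fin q → Fin q → ∀ J → (Fin J → Poly × Poly) → Series
  local ε a zero    w = 0ₛ
  local ε a (suc J) w = (eval (proj₁ (w fzero)) z ⊕ constant ε ⊛ (eval (proj₂ (w fzero)) z ⊛ G a 1# ys ^ₛ h)) ⊕ constant
      (- c + a * 1#) ⊛ local ε a J (w ∘ fsuc)
    where z = linear a (φ ys a)

  -- The quantities of large degree in a collapse here: f(a)^h becomes the constant ε, and a^q
  -- becomes a, so that each factor X^q - c costs one degree instead of q.
  auxiliary≋local : ∀ ε a → φ ys a ^ h ≡ ε → ∀ J w → eval (auxiliary J w) (linear a (φ ys a)) ≋ local ε a J w mod q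
  auxiliary≋local ε a e zero    w k k<q = refl
  auxiliary≋local ε a e (suc J) w k k<q = trans (eval-auxiliary J w z k) (cong₂ _+_
    (S.+-congˡ {eval r z} (S.trans (S.*-congˡ {eval s z} Φ^h)
        (solve 3 (λ s ε g → s :* (ε :* g) := ε :* (s :* g)) S.refl (eval s z) (constant ε) (G a 1# ys ^ₛ h))) k)
    (⊛-cong-mod {q} {z ^ₛ q ⊕ (S.- constant c)} {constant (- c + a * 1#)} {eval (auxiliary J (w ∘ fsuc)) z} Q≋
        (auxiliary≋local ε a e J (w ∘ fsuc)) k k<q))
    where
    open SSolver
    z = linear a (φ ys a)
    r = proj₁ (w fzero)
    s = proj₂ (w fzero)
    Φ^h : Φ ys z ^ₛ h ≋ constant ε ⊛ G a 1# ys ^ₛ h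
    Φ^h = S.trans (Exp.^-congˡ h (S.trans (Φ-cong ys (linear-cong {a} refl (sym (*-identityˡ (φ ys a)))))
        (Φ-factor a 1# ys)))
      (S.trans (Exp.^-distrib-* (constant (φ ys a)) (G a 1# ys) h) (S.*-congʳ {G a 1# ys ^ₛ h}
        (S.trans (constant-^ (φ ys a) h) (λ k → cong (λ x → constant x k) e))))
    Q≋ : z ^ₛ q ⊕ (S.- constant c) ≋ constant (- c + a * 1#) mod q
    Q≋ k k<q = trans (cong (_+ - constant c k) (linear-^q-mod a (φ ys a) k k<q)) (const k)
      where
      const : ∀ k → constant a k + - constant c k ≡ constant (- c + a * 1#) k
      const zero    = FSolver.solve 2 (λ a c → a FSolver.:+ FSolver.:- c FSolver.:= FSolver.:- c FSolver.:+ a FSolver.:*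
          FSolver.:1) refl a c
      const (suc k) = -‿inverseʳ 0#

  filtered-local : ∀ {D} ε J w → Short D w → Filtered d (D ℕ.+ J) (λ a → local ε a J w)
  filtered-local ε zero    w short k = degree-weaken z≤n (degree-const 0#)
  filtered-local {D} ε (suc J) w short = filtered-⊕
    (filtered-weaken (ℕ.m≤m+n D (suc J)) (filtered-⊕ (filtered-weaken (proj₁ (short fzero))
        (filtered-eval (proj₁ (w fzero)) Z))
      (filtered-⊛ (filtered-constant (degree-const ε))
        (filtered-weaken (ℕ.≤-trans (ℕ.≤-reflexive (ℕ.+-identityʳ _)) (proj₂ (short fzero)))
          (filtered-⊛ (filtered-eval (proj₂ (w fzero)) Z) (filtered-^ h (filtered-G ys (degree-const 1#) ℕ.≤-refl)))))))
    (filtered-weaken (ℕ.≤-reflexive (sym (ℕ.+-suc D J))) (filtered-⊛ (filtered-constant (degree-linear (- c) 1#))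
        (filtered-local ε J (w ∘ fsuc) (short ∘ fsuc))))
    where
    Z : Filtered d 1 (λ a → linear a (φ ys a))
    Z = filtered-linear (degree-cong (λ a → solve 1 (λ a → :0 :+ a :* :1 := a) refl a) (degree-linear 0# 1#))
        (degree-weaken (ℕ.n≤1+n d) (degree-φ ys))
      where open FSolver

  coeff-tabulate : ∀ {N} (u : Fin N → Fin q) i → coeff (tabulate u) (toℕ i) ≡ u i
  coeff-tabulate u fzero    = refl
  coeff-tabulate u (fsuc i) = coeff-tabulate (u ∘ fsuc) i

  module Count {D₀ : ℕ} (D≤ : D₀ ℕ.+ D₀ ℕ.+ d ≤ h ℕ.+ h) (J ℓ : ℕ) (ℓ≤q : ℓ ≤ q) (ε : Fin q) (ε≢0 : ε ≢ 0#) where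
    -- `M` counts the unknowns, the coefficients of J pairs of lists of length `D`. `K` is the
    -- number of coefficients sufficient for any of the first ℓ local coefficients, whose degree in
    -- a is at most D + J + ℓ d.
    D K M : ℕ
    D = suc D₀
    K = suc (D ℕ.+ J ℕ.+ ℓ ℕ.* d)
    M = J ℕ.* (D ℕ.+ D)

    left right : (Fin M → Fin q) → Fin J → Fin D → Fin q
    left  u j i = u (combine j (i ↑ˡ D))
    right u j i = u (combine j (D ↑ʳ i))

    decode : (Fin M → Fin q) → Fin J → Poly × Poly
    decode u j = tabulate (left u j) , tabulate (right u j)

    short : ∀ u → Short D (decode u)
    short u j = ℕ.≤-reflexive (List.length-tabulate (left u j)) , ℕ.≤-reflexive (List.length-tabulate (right u j))

    decode-injective : ∀ u v → (∀ j → proj₁ (decode u j) ≈ₚ proj₁ (decode v j) × proj₂ (decode u j) ≈ₚ proj₂ (decode v j)) →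
        ∀ k → u k ≡ v k
    decode-injective u v e k = subst (λ k → u k ≡ v k) (Fin.combine-remQuot {J} (D ℕ.+ D) k) (block (proj₁ jl) (proj₂ jl))
      where
      jl = remQuot {J} (D ℕ.+ D) k
      part : ∀ j (x : Fin D ⊎ Fin D) → u (combine j (join D D x)) ≡ v (combine j (join D D x))
      part j (inj₁ i) = trans (sym (coeff-tabulate (left u j) i)) (trans (proj₁ (e j) (toℕ i)) (coeff-tabulate (left v j) i))
      part j (inj₂ i) = trans (sym (coeff-tabulate (right u j) i))
          (trans (proj₂ (e j) (toℕ i)) (coeff-tabulate (right v j) i))
      block : ∀ j l → u (combine j l) ≡ v (combine j l)
      block j l = subst (λ l → u (combine j l) ≡ v (combine j l)) (Fin.join-splitAt D D l) (part j (splitAt D l))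

    localPoly : ∀ u (k : Fin ℓ) → Degree≤ (D ℕ.+ J ℕ.+ ℓ ℕ.* d) (λ a → local ε a J (decode u) (toℕ k))
    localPoly u k = degree-weaken (ℕ.+-monoʳ-≤ (D ℕ.+ J) (ℕ.*-monoˡ-≤ d (ℕ.<⇒≤ (Fin.toℕ<n k))))
        (filtered-local ε J (decode u) (short u) (toℕ k))

    constraints : (Fin M → Fin q) → Fin (ℓ ℕ.* K) → Fin q
    constraints u i = let k , j = remQuot {ℓ} K i in coeff (proj₁ (localPoly u k)) (toℕ j)

    constraints⇒local : ∀ u v → (∀ i → constraints u i ≡ constraints v i) →
      ∀ a k → k < ℓ → local ε a J (decode u) k ≡ local ε a J (decode v) k
    constraints⇒local u v e a k k<ℓ = subst (λ k → local ε a J (decode u) k ≡ local ε a J (decode v) k) (Fin.toℕ-fromℕ< k<ℓ)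
      (trans (proj₂ (proj₂ pu) a) (trans (value-coeff (proj₁ pu) (proj₁ pv) a coeff≡) (sym (proj₂ (proj₂ pv) a))))
      where
      k′ = fromℕ< k<ℓ
      pu = localPoly u k′
      pv = localPoly v k′
      at : ∀ (j : Fin K) → coeff (proj₁ pu) (toℕ j) ≡ coeff (proj₁ pv) (toℕ j)
      at j = subst (λ kj → coeff (proj₁ (localPoly u (proj₁ kj))) (toℕ (proj₂ kj)) ≡ coeff (proj₁ (localPoly v (proj₁ kj)))
          (toℕ (proj₂ kj)))
        (Fin.remQuot-combine k′ j) (e (combine k′ j))
      coeff≡ : proj₁ pu ≈ₚ proj₁ pv
      coeff≡ i with i ℕ.<? K
      ... | yes i<K = subst (λ i → coeff (proj₁ pu) i ≡ coeff (proj₁ pv) i) (Fin.toℕ-fromℕ< i<K) (at (fromℕ< i<K))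
      ... | no  i≮K = trans (coeff-≥length (proj₁ pu) (ℕ.≤-trans (proj₁ (proj₂ pu)) (ℕ.≮⇒≥ i≮K)))
                       (sym (coeff-≥length (proj₁ pv) (ℕ.≤-trans (proj₁ (proj₂ pv)) (ℕ.≮⇒≥ i≮K))))

    1<q : 1 < q
    1<q = s≤s (ℕ.≤-trans 0<h (ℕ.m≤m+n h h))

    -- There are q^M coefficient vectors but only q^(ℓ K) possible values of `constraints`.
    -- Comparing cardinalities plays the part of a dimension count for a linear system.
    collision : ℓ ℕ.* K < M → ∃[ u ] ∃[ v ] (¬ (∀ i → u i ≡ v i) × (∀ i → constraints u i ≡ constraints v i))
    collision K<M with x , y , x<y , same ← Fin.pigeonhole (ℕ.^-monoʳ-< q 1<q K<M)
        (λ x → funToFin (constraints (finToFun {q} {M} x))) =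
      finToFun x , finToFun y , (λ e → Fin.<⇒≢ x<y (coordinates-≡⇒≡ {q} {M} x y e)) ,
      λ i → trans (sym (Fin.finToFun-funToFin (constraints (finToFun x)) i))
        (trans (cong (λ s → finToFun s i) same) (Fin.finToFun-funToFin (constraints (finToFun y)) i))

    -- If the bound failed, the difference of the two auxiliary polynomials would have zeros of
    -- total multiplicity at least its length and would vanish; injectivity would then identify the
    -- two coefficient vectors.
    count : ℓ ℕ.* K < M → ∀ zs → Unique zs → All (λ a → φ ys a ^ h ≡ ε) zs → length zs ℕ.* ℓ ≤ D ℕ.+ h ℕ.* d ℕ.+ J ℕ.* q
    count K<M zs uzs all with u , v , u≢v , same ← collision K<M
      with length zs ℕ.* ℓ ℕ.≤? D ℕ.+ h ℕ.* d ℕ.+ J ℕ.* q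
    ... | yes ok = ok
    ... | no  ¬ok = ⊥-elim (u≢v (decode-injective u v (auxiliary-injective D≤ J (decode u) (decode v) (short u) (short v)
        equal)))
      where
      A B : Poly
      A = auxiliary J (decode u)
      B = auxiliary J (decode v)
      -- A zero of order ℓ may be tested with the slope f(a) only if this slope is nonzero, which ε
      -- ≠ 0 guarantees.
      φ≢0 : ∀ a → φ ys a ^ h ≡ ε → φ ys a ≢ 0#
      φ≢0 a e φ≡0 = ε≢0 (trans (sym e) (trans (cong (_^ h) φ≡0) 0^h≡0))
      root : ∀ {a} → φ ys a ^ h ≡ ε → RootOrder (A ⊟ B) a ℓ
      root {a} e = φ ys a , φ≢0 a e , λ k k<ℓ → trans (eval-⊟ A B (linear a (φ ys a)) k) (≡⇒-≡0
        (trans (auxiliary≋local ε a e J (decode u) k (ℕ.<-≤-trans k<ℓ ℓ≤q))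
        (trans (constraints⇒local u v same a k k<ℓ) (sym (auxiliary≋local ε a e J (decode v) k (ℕ.<-≤-trans k<ℓ ℓ≤q))))))
      zero-diff : ∀ i → coeff (A ⊟ B) i ≡ 0#
      zero-diff = highRoots⇒0 ℓ zs (A ⊟ B) uzs (All.map root all)
        (ℕ.≤-trans (length-⊟ A B (length-auxiliary J (decode u) (short u)) (length-auxiliary J (decode v) (short v)))
            (ℕ.≰⇒> ¬ok))
      equal : eval A z₀ ≋ eval B z₀
      equal k = -≡0 (trans (sym (eval-⊟ A B z₀ k)) (eval-coeff-0 (A ⊟ B) z₀ zero-diff k))

open import Data.Integer as ℤ using (ℤ; +_; -[1+_]; 1ℤ; 0ℤ; -1ℤ; ∣_∣)

-- Integer sums over lists

module SumsOverLists {A : Set} where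
  sum : (A → ℤ) → List A → ℤ
  sum g []       = 0ℤ
  sum g (x ∷ xs) = g x ℤ.+ sum g xs

  sum-cong : ∀ {g g′} xs → (∀ x → g x ≡ g′ x) → sum g xs ≡ sum g′ xs
  sum-cong []       e = refl
  sum-cong (x ∷ xs) e = cong₂ ℤ._+_ (e x) (sum-cong xs e)

  sum-+* : ∀ s g g′ xs → sum (λ x → g x ℤ.+ s ℤ.* g′ x) xs ≡ sum g xs ℤ.+ s ℤ.* sum g′ xs
  sum-+* s g g′ []       = sym (trans (ℤ.+-identityˡ _) (ℤ.*-zeroʳ s))
  sum-+* s g g′ (x ∷ xs) = trans (cong (λ w → (g x ℤ.+ s ℤ.* g′ x) ℤ.+ w) (sum-+* s g g′ xs))
      (lemma s (g x) (g′ x) (sum g xs) (sum g′ xs))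
    where
    lemma : ∀ s a b c d → (a ℤ.+ s ℤ.* b) ℤ.+ (c ℤ.+ s ℤ.* d) ≡ (a ℤ.+ c) ℤ.+ s ℤ.* (b ℤ.+ d)
    lemma = ℤ-Solver.solve-∀

  sum-one : ∀ xs → sum (λ _ → 1ℤ) xs ≡ + length xs
  sum-one []       = refl
  sum-one (x ∷ xs) = cong (λ w → 1ℤ ℤ.+ w) (sum-one xs)

  sum-≤-count : ∀ {P : Pred A 0ℓ} (P? : Decidable P) (B : ℕ) {g : A → ℤ} → (∀ x → P x → g x ℤ.≤ + B) →
      (∀ x → ¬ P x → g x ℤ.≤ 0ℤ) →
                ∀ xs → sum g xs ℤ.≤ + (length (filter P? xs) ℕ.* B)
  sum-≤-count P? B on off []       = ℤ.≤-refl
  sum-≤-count P? B on off (x ∷ xs) with P? x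
  ... | yes p = ℤ.+-mono-≤ (on x p) (sum-≤-count P? B on off xs)
  ... | no ¬p = ℤ.+-mono-≤ (off x ¬p) (sum-≤-count P? B on off xs)

  sum-neg : ∀ g xs → sum (λ x → ℤ.- g x) xs ≡ ℤ.- sum g xs
  sum-neg g []       = refl
  sum-neg g (x ∷ xs) = trans (cong (λ w → ℤ.- g x ℤ.+ w) (sum-neg g xs)) (sym (ℤ.neg-distrib-+ (g x) (sum g xs)))

  -- Adding 1 to every term turns the values -1, 0, 1 into 0, 1, 2, so the points of value -1 are
  -- never counted.
  sum-signs : ∀ {P Z : Pred A 0ℓ} (P? : Decidable P) (Z? : Decidable Z) {g : A → ℤ} →
              (∀ x → P x → ¬ Z x × g x ≡ 1ℤ) → (∀ x → Z x → g x ≡ 0ℤ) → (∀ x → ¬ P x → ¬ Z x → g x ≡ -1ℤ) →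
              ∀ xs → sum g xs ℤ.+ + length xs ≡ + (2 ℕ.* length (filter P? xs) ℕ.+ length (filter Z? xs))
  sum-signs P? Z? onP onZ off [] = refl
  sum-signs P? Z? {g} onP onZ off (x ∷ xs) with sum-signs P? Z? onP onZ off xs | P? x | Z? x
  ... | ih | yes p | yes z = ⊥-elim (proj₁ (onP x p) z)
  ... | ih | yes p | no  _ = trans (cong (λ w → (w ℤ.+ sum g xs) ℤ.+ (1ℤ ℤ.+ + length xs)) (proj₂ (onP x p)))
        (trans (lemma (sum g xs) (+ length xs)) (trans (cong (λ w → + 2 ℤ.+ w) ih)
            (cong +_ (lemma′ (length (filter P? xs)) _))))
    where
    lemma : ∀ s l → (1ℤ ℤ.+ s) ℤ.+ (1ℤ ℤ.+ l) ≡ + 2 ℤ.+ (s ℤ.+ l)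
    lemma = ℤ-Solver.solve-∀
    lemma′ : ∀ a b → 2 ℕ.+ (2 ℕ.* a ℕ.+ b) ≡ 2 ℕ.* suc a ℕ.+ b
    lemma′ = solve-∀
  ... | ih | no  _ | yes z = trans (cong (λ w → (w ℤ.+ sum g xs) ℤ.+ (1ℤ ℤ.+ + length xs)) (onZ x z))
        (trans (lemma (sum g xs) (+ length xs)) (trans (cong (λ w → 1ℤ ℤ.+ w) ih)
            (cong +_ (sym (ℕ.+-suc (2 ℕ.* length (filter P? xs)) _)))))
    where
    lemma : ∀ s l → (0ℤ ℤ.+ s) ℤ.+ (1ℤ ℤ.+ l) ≡ 1ℤ ℤ.+ (s ℤ.+ l)
    lemma = ℤ-Solver.solve-∀
  ... | ih | no ¬p | no ¬z = trans (cong (λ w → (w ℤ.+ sum g xs) ℤ.+ (1ℤ ℤ.+ + length xs)) (off x ¬p ¬z))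
      (trans (lemma (sum g xs) (+ length xs)) ih)
    where
    lemma : ∀ s l → (-1ℤ ℤ.+ s) ℤ.+ (1ℤ ℤ.+ l) ≡ s ℤ.+ l
    lemma = ℤ-Solver.solve-∀

open SumsOverLists

a*n+a*n≡2a*n : ∀ a n → a ℕ.* n ℕ.+ a ℕ.* n ≡ 2 ℕ.* a ℕ.* n
a*n+a*n≡2a*n = solve-∀

∣s*i∣≡∣i∣ : ∀ (b : Bool) i → ∣ (if b then 1ℤ else -1ℤ) ℤ.* i ∣ ≡ ∣ i ∣
∣s*i∣≡∣i∣ true  i = cong ∣_∣ (ℤ.*-identityˡ i)
∣s*i∣≡∣i∣ false i = trans (cong ∣_∣ (ℤ.-1*i≡-i i)) (ℤ.∣-i∣≡∣i∣ i)

-- The quadratic character and the expansion over sign patterns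

module CharacterSums {h : ℕ} (F : FieldOn (suc (h ℕ.+ h))) (0<h : 0 < h) where
  open FieldOn F using (0#; 1#; _+_; _*_; -_; 0≢1)
  open FieldAlgebra F
  open Fermat F
  open Products F
  open OddField F 0<h
  open CommutativeRing fieldRing using (*-identityˡ; *-identityʳ; zeroˡ; zeroʳ)

  elements : List (Fin q)
  elements = allFin q

  length-elements : length elements ≡ q
  length-elements = List.length-tabulate {n = q} (λ i → i)

  -- Evaluated at the variable, each factor y - U is either a unit or -U, and both can be cancelled.
  f≢0 : ∀ S → ¬ (∀ i → coeff (f S) i ≡ 0#)
  f≢0 S e = Φ≢0 S (S.trans (S.sym (eval-f S U)) (λ i → trans (sym (coeff≡eval (f S) i)) (e i)))
    where
    Φ≢0 : ∀ S → ¬ (Φ S U ≋ 0ₛ)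
    Φ≢0 []      e = 0≢1 (sym (e 0))
    Φ≢0 (y ∷ S) e with y + - 0# Fin.≟ 0#
    ... | no  y≢0 = Φ≢0 S (λ k → linear-cancel-mod (suc k) y≢0
        (λ j _ → trans (sym (S.*-congʳ {Φ S U} (constant-linear y 0# 1#) j)) (e j)) k ℕ.≤-refl)
    ... | yes y≡0 = Φ≢0 S (λ k → linear0-cancel-mod (suc k) -1≢0
        (λ j _ → trans (sym (S.*-congʳ {Φ S U} (S.trans (constant-linear y 0# 1#) (linear-cong y≡0 refl)) j)) (e j)) k
            ℕ.≤-refl)

  zeros : List (Fin q) → List (Fin q)
  zeros S = filter (λ x → φ S x Fin.≟ 0#) elements

  length-zeros : ∀ S → length (zeros S) ≤ length S
  length-zeros S with length (zeros S) ℕ.≤? length S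
  ... | yes ok = ok
  ... | no ¬ok = ⊥-elim (f≢0 S (simpleRoots⇒0 (zeros S) (f S) (Unique.filter⁺ (λ x → φ S x Fin.≟ 0#) (Unique.allFin⁺ q))
    (All.map (λ {x} e → trans (value-f S x) e) (All.all-filter (λ x → φ S x Fin.≟ 0#) elements))
    (ℕ.≤-trans (length-f S) (ℕ.≰⇒> ¬ok))))

  φ-nonzero : ∀ S → length S < q → ∃[ c ] (φ S c ≢ 0#)
  φ-nonzero S S<q with Fin.any? (λ x → ¬? (φ S x Fin.≟ 0#))
  ... | yes found = found
  ... | no  none  = ⊥-elim (f≢0 S (simpleRoots⇒0 elements (f S) (Unique.allFin⁺ q) (All.tabulate⁺ vanish)
    (ℕ.≤-trans (length-f S) (ℕ.≤-trans S<q (ℕ.≤-reflexive (sym length-elements))))))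
    where
    vanish : ∀ x → value (f S) x ≡ 0#
    vanish x with φ S x Fin.≟ 0#
    ... | yes e = trans (value-f S x) e
    ... | no  e = ⊥-elim (none (x , e))

  χ : Fin q → ℤ
  χ x with x ^ h Fin.≟ 1# | x ^ h Fin.≟ - 1#
  ... | yes _ | _     = 1ℤ
  ... | no  _ | yes _ = -1ℤ
  ... | no  _ | no  _ = 0ℤ

  χ≡1 : ∀ {x} → x ^ h ≡ 1# → χ x ≡ 1ℤ
  χ≡1 {x} e with x ^ h Fin.≟ 1# | x ^ h Fin.≟ - 1#
  ... | yes _ | _ = refl
  ... | no  n | _ = ⊥-elim (n e)

  χ≡-1 : ∀ {x} → x ^ h ≡ - 1# → χ x ≡ -1ℤ
  χ≡-1 {x} e with x ^ h Fin.≟ 1# | x ^ h Fin.≟ - 1#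
  ... | yes e′ | _     = ⊥-elim (1≢-1 (trans (sym e′) e))
  ... | no  _  | yes _ = refl
  ... | no  _  | no  n = ⊥-elim (n e)

  χ≡0 : ∀ {x} → x ≡ 0# → χ x ≡ 0ℤ
  χ≡0 refl with 0# ^ h Fin.≟ 1# | 0# ^ h Fin.≟ - 1#
  ... | yes e | _     = ⊥-elim (0≢1 (trans (sym 0^h≡0) e))
  ... | no  _ | yes e = ⊥-elim (-1≢0 (trans (sym e) 0^h≡0))
  ... | no  _ | no  _ = refl

  sign : ∀ x → x ≡ 0# ⊎ (x ^ h ≡ 1# ⊎ x ^ h ≡ - 1#)
  sign x with x Fin.≟ 0#
  ... | yes e = inj₁ e
  ... | no  n = inj₂ (^h-sign x n)

  χ-* : ∀ x y → χ (x * y) ≡ χ x ℤ.* χ y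
  χ-* x y with sign x | sign y
  ... | inj₁ x≡0 | _ = trans (χ≡0 (trans (cong (_* y) x≡0) (zeroˡ y)))
      (sym (trans (cong (ℤ._* χ y) (χ≡0 x≡0)) (ℤ.*-zeroˡ (χ y))))
  ... | inj₂ _ | inj₁ y≡0 = trans (χ≡0 (trans (cong (x *_) y≡0) (zeroʳ x)))
      (sym (trans (cong (χ x ℤ.*_) (χ≡0 y≡0)) (ℤ.*-zeroʳ (χ x))))
  ... | inj₂ (inj₁ e) | inj₂ (inj₁ e′) = trans (χ≡1 (trans (^-distrib-* x y h) (trans (cong₂ _*_ e e′) (*-identityˡ 1#))))
      (sym (cong₂ ℤ._*_ (χ≡1 e) (χ≡1 e′)))
  ... | inj₂ (inj₁ e) | inj₂ (inj₂ e′) = trans (χ≡-1 (trans (^-distrib-* x y h)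
      (trans (cong₂ _*_ e e′) (*-identityˡ (- 1#))))) (sym (cong₂ ℤ._*_ (χ≡1 e) (χ≡-1 e′)))
  ... | inj₂ (inj₂ e) | inj₂ (inj₁ e′) = trans (χ≡-1 (trans (^-distrib-* x y h)
      (trans (cong₂ _*_ e e′) (*-identityʳ (- 1#))))) (sym (cong₂ ℤ._*_ (χ≡-1 e) (χ≡1 e′)))
  ... | inj₂ (inj₂ e) | inj₂ (inj₂ e′) = trans (χ≡1 (trans (^-distrib-* x y h)
      (trans (cong₂ _*_ e e′) (solve 0 ((:- :1) :* (:- :1) := :1) refl)))) (sym (cong₂ ℤ._*_ (χ≡-1 e) (χ≡-1 e′)))
    where open FSolver

  fibre : List (Fin q) → Fin q → List (Fin q)
  fibre S ε = filter (λ x → φ S x ^ h Fin.≟ ε) elements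

  sum-χ : ∀ S → sum (λ x → χ (φ S x)) elements ℤ.+ + length elements ≡ + (2 ℕ.* length (fibre S 1#) ℕ.+ length (zeros S))
  sum-χ S = sum-signs (λ x → φ S x ^ h Fin.≟ 1#) (λ x → φ S x Fin.≟ 0#)
    (λ x e → (λ e′ → 0≢1 (trans (sym 0^h≡0) (trans (cong (_^ h) (sym e′)) e))) , χ≡1 e) (λ x → χ≡0) off elements
    where
    off : ∀ x → φ S x ^ h ≢ 1# → φ S x ≢ 0# → χ (φ S x) ≡ -1ℤ
    off x n n′ with sign (φ S x)
    ... | inj₁ e = ⊥-elim (n′ e)
    ... | inj₂ (inj₁ e) = ⊥-elim (n e)
    ... | inj₂ (inj₂ e) = χ≡-1 e

  sum-χ⁻ : ∀ S → ℤ.- sum (λ x → χ (φ S x)) elements ℤ.+ + length elements ≡ +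
      (2 ℕ.* length (fibre S (- 1#)) ℕ.+ length (zeros S))
  sum-χ⁻ S = trans (cong (λ w → w ℤ.+ + length elements) (sym (sum-neg (λ x → χ (φ S x)) elements)))
    (sum-signs (λ x → φ S x ^ h Fin.≟ - 1#) (λ x → φ S x Fin.≟ 0#)
    (λ x e → (λ e′ → -1≢0 (trans (sym (trans (cong (_^ h) (sym e′)) e)) 0^h≡0)) , cong ℤ.-_ (χ≡-1 e))
        (λ x e → cong ℤ.-_ (χ≡0 e)) off elements)
    where
    off : ∀ x → φ S x ^ h ≢ - 1# → φ S x ≢ 0# → ℤ.- χ (φ S x) ≡ -1ℤ
    off x n n′ with sign (φ S x)
    ... | inj₁ e = ⊥-elim (n′ e)
    ... | inj₂ (inj₁ e) = cong ℤ.-_ (χ≡1 e)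
    ... | inj₂ (inj₂ e) = ⊥-elim (n e)

  -- The two identities `sum-χ` and `sum-χ⁻` turn upper bounds for the two fibres into a two-sided
  -- bound for the sum.
  ∣i∣≤ : ∀ {i} {N A B E : ℕ} → i ℤ.+ + N ≡ + A → ℤ.- i ℤ.+ + N ≡ + B → A ≤ N ℕ.+ E → B ≤ N ℕ.+ E → ∣ i ∣ ≤ E
  ∣i∣≤ {+ k}      {N} e _ A≤ _ = ℕ.+-cancelˡ-≤ N _ _ (ℕ.≤-trans (ℕ.≤-reflexive (trans (ℕ.+-comm N k) (ℤ.+-injective e))) A≤)
  ∣i∣≤ { -[1+ k ]} {N} _ e _ B≤ = ℕ.+-cancelˡ-≤ N _ _ (ℕ.≤-trans
      (ℕ.≤-reflexive (trans (ℕ.+-comm N (suc k)) (ℤ.+-injective e))) B≤)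

  signed : Bool → ℤ
  signed b = if b then 1ℤ else -1ℤ

  Pattern : Set
  Pattern = List (Fin q × Bool)

  points : Pattern → List (Fin q)
  points = map proj₁

  weight : Pattern → Fin q → ℤ
  weight []             x = 1ℤ
  weight ((y , b) ∷ ps) x = (1ℤ ℤ.+ signed b ℤ.* χ (y + - x)) ℤ.* weight ps x

  Realises : Pattern → Fin q → Set
  Realises ps x = All (λ (y , b) → χ (y + - x) ≡ signed b) ps

  -- An intermediate stage of expanding the product: S holds the points whose character has been
  -- selected, `ps` the factors still unexpanded. `twisted ps []` is the full weighted count,
  -- `twisted [] S` a pure character sum.
  twisted : Pattern → List (Fin q) → ℤ
  twisted ps S = sum (λ x → weight ps x ℤ.* χ (φ S x)) elements

  twisted-∷ : ∀ y b ps S → twisted ((y , b) ∷ ps) S ≡ twisted ps S ℤ.+ signed b ℤ.* twisted ps (y ∷ S)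
  twisted-∷ y b ps S = trans (sum-cong elements (λ x → trans (lemma (signed b) (χ (y + - x)) (weight ps x) (χ (φ S x)))
      (cong (λ w → weight ps x ℤ.* χ (φ S x) ℤ.+ signed b ℤ.* (weight ps x ℤ.* w)) (sym (χ-* (y + - x) (φ S x))))))
    (sum-+* (signed b) (λ x → weight ps x ℤ.* χ (φ S x)) (λ x → weight ps x ℤ.* χ (φ (y ∷ S) x)) elements)
    where
    lemma : ∀ s c w p → ((1ℤ ℤ.+ s ℤ.* c) ℤ.* w) ℤ.* p ≡ w ℤ.* p ℤ.+ s ℤ.* (w ℤ.* (c ℤ.* p))
    lemma = ℤ-Solver.solve-∀

  factor-cases : ∀ b y x → y ≡ x ⊎ χ (y + - x) ≡ signed b ⊎ 1ℤ ℤ.+ signed b ℤ.* χ (y + - x) ≡ 0ℤ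
  factor-cases b y x with sign (y + - x)
  ... | inj₁ e = inj₁ (-≡0 e)
  factor-cases true  y x | inj₂ (inj₁ e) = inj₂ (inj₁ (χ≡1 e))
  factor-cases false y x | inj₂ (inj₁ e) = inj₂ (inj₂ (cong (λ c → 1ℤ ℤ.+ -1ℤ ℤ.* c) (χ≡1 e)))
  factor-cases true  y x | inj₂ (inj₂ e) = inj₂ (inj₂ (cong (λ c → 1ℤ ℤ.+ 1ℤ ℤ.* c) (χ≡-1 e)))
  factor-cases false y x | inj₂ (inj₂ e) = inj₂ (inj₁ (χ≡-1 e))

  signed² : ∀ b → 1ℤ ℤ.+ signed b ℤ.* signed b ≡ + 2
  signed² true  = refl
  signed² false = refl

  weight-bound : ∀ ps x → ∃[ k ] (weight ps x ≡ + k × k ≤ 2 ℕ.^ length ps)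
  weight-bound []             x = 1 , refl , ℕ.≤-refl
  weight-bound ((y , b) ∷ ps) x with weight-bound ps x | factor-cases b y x
  ... | k , e , k≤ | inj₁ y≡x = k , trans (cong₂ ℤ._*_ (trans (cong (λ c → 1ℤ ℤ.+ signed b ℤ.* c) (χ≡0 (≡⇒-≡0 y≡x)))
      (cong (λ w → 1ℤ ℤ.+ w) (ℤ.*-zeroʳ (signed b)))) e) (ℤ.*-identityˡ (+ k)) , ℕ.≤-trans k≤ (ℕ.m≤m+n _ _)
  ... | k , e , k≤ | inj₂ (inj₁ χ≡s) = 2 ℕ.* k , trans (cong₂ ℤ._*_
      (trans (cong (λ c → 1ℤ ℤ.+ signed b ℤ.* c) χ≡s) (signed² b)) e) (sym (ℤ.pos-* 2 k)) , ℕ.*-monoʳ-≤ 2 k≤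
  ... | k , e , k≤ | inj₂ (inj₂ 0≡) = 0 , trans (cong (ℤ._* weight ps x) 0≡) (ℤ.*-zeroˡ (weight ps x)) , z≤n

  weight-cases : ∀ ps x → Realises ps x ⊎ weight ps x ≡ 0ℤ ⊎ φ (points ps) x ≡ 0#
  weight-cases []             x = inj₁ []
  weight-cases ((y , b) ∷ ps) x with factor-cases b y x | weight-cases ps x
  ... | inj₁ y≡x | _ = inj₂ (inj₂ (trans (cong (_* φ (points ps) x) (≡⇒-≡0 y≡x)) (zeroˡ _)))
  ... | inj₂ (inj₂ 0≡) | _ = inj₂ (inj₁ (trans (cong (ℤ._* weight ps x) 0≡) (ℤ.*-zeroˡ (weight ps x))))
  ... | inj₂ (inj₁ χ≡s) | inj₁ r = inj₁ (χ≡s ∷ r)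
  ... | inj₂ (inj₁ χ≡s) | inj₂ (inj₁ w≡0) = inj₂ (inj₁ (trans (cong ((1ℤ ℤ.+ signed b ℤ.* χ (y + - x)) ℤ.*_) w≡0)
      (ℤ.*-zeroʳ (1ℤ ℤ.+ signed b ℤ.* χ (y + - x)))))
  ... | inj₂ (inj₁ χ≡s) | inj₂ (inj₂ φ≡0) = inj₂ (inj₂ (trans (cong ((y + - x) *_) φ≡0) (zeroʳ _)))

  χ[1]≡1 : χ 1# ≡ 1ℤ
  χ[1]≡1 = χ≡1 (trans (cong (_^ h) (sym (*-identityˡ 1#))) (square-^h 1# (0≢1 ∘ sym)))

  -- Without a realising x, every term vanishes or is nonpositive except at the points of the
  -- pattern themselves, where a factor is 1 and the weight is at most 2^n.
  twisted-unrealised : ∀ ps → (∀ x → ¬ Realises ps x) → twisted ps [] ℤ.≤ + (length ps ℕ.* 2 ℕ.^ length ps)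
  twisted-unrealised ps none = ℤ.≤-trans (sum-≤-count (λ x → φ (points ps) x Fin.≟ 0#) (2 ℕ.^ length ps) on off elements)
    (ℤ.+≤+ (ℕ.*-monoˡ-≤ (2 ℕ.^ length ps) (ℕ.≤-trans (length-zeros (points ps)) (ℕ.≤-reflexive (List.length-map proj₁ ps)))))
    where
    term≡ : ∀ x → weight ps x ℤ.* χ 1# ≡ weight ps x
    term≡ x = trans (cong (weight ps x ℤ.*_) χ[1]≡1) (ℤ.*-identityʳ (weight ps x))
    on : ∀ x → φ (points ps) x ≡ 0# → weight ps x ℤ.* χ 1# ℤ.≤ + (2 ℕ.^ length ps)
    on x _ with k , e , k≤ ← weight-bound ps x = ℤ.≤-trans (ℤ.≤-reflexive (trans (term≡ x) e)) (ℤ.+≤+ k≤)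
    off : ∀ x → φ (points ps) x ≢ 0# → weight ps x ℤ.* χ 1# ℤ.≤ 0ℤ
    off x φ≢0 with weight-cases ps x
    ... | inj₁ r = ⊥-elim (none x r)
    ... | inj₂ (inj₁ w≡0) = ℤ.≤-reflexive (trans (term≡ x) w≡0)
    ... | inj₂ (inj₂ φ≡0) = ⊥-elim (φ≢0 φ≡0)

  module _ (n E : ℕ) (bound : ∀ y S → Unique (y ∷ S) → length (y ∷ S) ≤ n → ∣ sum (λ x → χ (φ (y ∷ S) x)) elements ∣ ≤ E)
      where

    -- Every factor still unexpanded doubles the number of character sums. Since S is nonempty from
    -- the start, the main term never occurs; disjointness keeps the enlarged S free of repetitions.
    twisted-∷-bound : ∀ ps y S → Unique (points ps) → Unique (y ∷ S) → All (λ z → All (z ≢_) (y ∷ S)) (points ps) →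
                      length ps ℕ.+ length (y ∷ S) ≤ n → ∣ twisted ps (y ∷ S) ∣ ≤ 2 ℕ.^ length ps ℕ.* E
    twisted-∷-bound [] y S _ u _ len = ℕ.≤-trans (ℕ.≤-reflexive
        (cong ∣_∣ (sum-cong elements (λ x → ℤ.*-identityˡ (χ (φ (y ∷ S) x))))))
      (ℕ.≤-trans (bound y S u len) (ℕ.≤-reflexive (sym (ℕ.+-identityʳ E))))
    twisted-∷-bound ((z , b) ∷ ps) y S (z∉ps ∷ ups) u (z∉S ∷ disjoint) len = begin
      ∣ twisted ((z , b) ∷ ps) (y ∷ S) ∣
        ≡⟨ cong ∣_∣ (twisted-∷ z b ps (y ∷ S)) ⟩
      ∣ twisted ps (y ∷ S) ℤ.+ signed b ℤ.* twisted ps (z ∷ y ∷ S) ∣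
        ≤⟨ ℤ.∣i+j∣≤∣i∣+∣j∣ (twisted ps (y ∷ S)) _ ⟩
      ∣ twisted ps (y ∷ S) ∣ ℕ.+ ∣ signed b ℤ.* twisted ps (z ∷ y ∷ S) ∣
        ≡⟨ cong (∣ twisted ps (y ∷ S) ∣ ℕ.+_) (∣s*i∣≡∣i∣ b (twisted ps (z ∷ y ∷ S))) ⟩
      ∣ twisted ps (y ∷ S) ∣ ℕ.+ ∣ twisted ps (z ∷ y ∷ S) ∣
        ≤⟨ ℕ.+-mono-≤ (twisted-∷-bound ps y S ups u disjoint (ℕ.<⇒≤ len))
             (twisted-∷-bound ps z (y ∷ S) ups (z∉S ∷ u) (All.zipWith (λ (z≢w , w∉) → z≢w ∘ sym ∷ w∉) (z∉ps , disjoint))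
                 (ℕ.≤-trans (ℕ.≤-reflexive (ℕ.+-suc (length ps) _)) len)) ⟩
      2 ℕ.^ length ps ℕ.* E ℕ.+ 2 ℕ.^ length ps ℕ.* E
        ≡⟨ a*n+a*n≡2a*n (2 ℕ.^ length ps) E ⟩
      2 ℕ.^ length ((z , b) ∷ ps) ℕ.* E
        ∎
      where
      open ℕ.≤-Reasoning

    -- The empty selection contributes q. Expanding one more factor adds selections through the new
    -- point z, and their total error equals the bound accumulated before, so that this bound
    -- doubles.
    twisted-lower : ∀ ps → Unique (points ps) → length ps ≤ n → + q ℤ.≤ twisted ps [] ℤ.+ + (2 ℕ.^ length ps ℕ.* E)
    twisted-lower [] _ _ = ℤ.≤-trans (ℤ.≤-reflexive (sym (trans
        (sum-cong elements (λ x → trans (ℤ.*-identityˡ (χ 1#)) χ[1]≡1))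
      (trans (sum-one elements) (cong +_ length-elements))))) (ℤ.i≤i+j (twisted [] []) _)
    twisted-lower ((z , b) ∷ ps) (z∉ps ∷ ups) len = begin
      + q
        ≤⟨ twisted-lower ps ups (ℕ.<⇒≤ len) ⟩
      T ℤ.+ + B
        ≡⟨ lemma T (+ B) T′ ⟩
      (T ℤ.+ T′) ℤ.+ (ℤ.- T′ ℤ.+ + B)
        ≤⟨ ℤ.+-monoʳ-≤ (T ℤ.+ T′) (ℤ.+-monoˡ-≤ (+ B) -T′≤B) ⟩
      (T ℤ.+ T′) ℤ.+ (+ B ℤ.+ + B)
        ≡⟨ cong₂ ℤ._+_ (sym (twisted-∷ z b ps [])) (cong +_ (a*n+a*n≡2a*n (2 ℕ.^ length ps) E)) ⟩
      twisted ((z , b) ∷ ps) [] ℤ.+ + (2 ℕ.^ length ((z , b) ∷ ps) ℕ.* E)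
        ∎
      where
      open ℤ.≤-Reasoning
      T T′ : ℤ
      T  = twisted ps []
      T′ = signed b ℤ.* twisted ps (z ∷ [])
      B : ℕ
      B = 2 ℕ.^ length ps ℕ.* E
      lemma : ∀ t b t′ → t ℤ.+ b ≡ (t ℤ.+ t′) ℤ.+ (ℤ.- t′ ℤ.+ b)
      lemma = ℤ-Solver.solve-∀
      ∣T′∣≤B : ∣ T′ ∣ ≤ B
      ∣T′∣≤B = ℕ.≤-trans (ℕ.≤-reflexive (∣s*i∣≡∣i∣ b (twisted ps (z ∷ [])))) (twisted-∷-bound ps z [] ups ([] ∷ [])
        (All.map (λ z≢w → z≢w ∘ sym ∷ []) z∉ps) (ℕ.≤-trans (ℕ.≤-reflexive (ℕ.+-comm (length ps) 1)) len))
      -i≤∣i∣ : ∀ i → ℤ.- i ℤ.≤ + ∣ i ∣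
      -i≤∣i∣ (+ zero)  = ℤ.≤-refl
      -i≤∣i∣ (+ suc k) = ℤ.-≤+
      -i≤∣i∣ -[1+ k ]  = ℤ.≤-refl
      -T′≤B : ℤ.- T′ ℤ.≤ + B
      -T′≤B = ℤ.≤-trans (-i≤∣i∣ T′) (ℤ.+≤+ ∣T′∣≤B)

    realised : ∀ ps → Unique (points ps) → length ps ≤ n → length ps ℕ.* 2 ℕ.^ length ps ℕ.+ 2 ℕ.^ length ps ℕ.* E < q → ∃[ x
        ] Realises ps x
    realised ps u len small with Fin.any? (λ x → All.all? (λ (y , b) → χ (y + - x) ℤ.≟ signed b) ps)
    ... | yes found = found
    ... | no  none  = ⊥-elim (ℕ.<⇒≱ small (ℤ.drop‿+≤+ (ℤ.≤-trans (twisted-lower ps u len)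
      (ℤ.+-monoˡ-≤ (+ (2 ℕ.^ length ps ℕ.* E)) (twisted-unrealised ps (λ x r → none (x , r)))))))

-- The parameters of Stepanov's method are ℓ = 2m, J = m + 10d and D₀ = h − d, where m = ⌊√q⌋.
constraints<unknowns : ∀ m d D₀ → 1 ≤ d → d ≤ m → 12 ≤ m → m ℕ.* m ≤ suc ((D₀ ℕ.+ d) ℕ.+ (D₀ ℕ.+ d)) →
  2 ℕ.* m ℕ.* suc (suc D₀ ℕ.+ (m ℕ.+ 10 ℕ.* d) ℕ.+ 2 ℕ.* m ℕ.* d) < (m ℕ.+ 10 ℕ.* d) ℕ.* (suc D₀ ℕ.+ suc D₀)
-- The terms 2m(D₀ + 1) agree on both sides, so the surplus 10d in J must outweigh 4dm² and smaller
-- terms. Adding 20d² completes 20dD₀ + 10d to 10d(2(D₀ + d) + 1), hence to at least 10dm². The 10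
-- is 6 + 4: the terms in m² give 6dm², and m ≥ 12 makes 42dm at most 4dm².
constraints<unknowns m d D₀ 1≤d d≤m 12≤m m²≤q = ℕ.+-cancelʳ-≤ (20 * (d * d)) _ _ (begin
  suc (2 * m * suc (suc D₀ + (m + 10 * d) + 2 * m * d)) + 20 * (d * d)
    ≡⟨ expandˡ m d D₀ ⟩
  (2 * m + 2 * (m * D₀)) + (1 + 2 * m + 2 * (m * m) + 20 * (d * m) + 4 * (d * (m * m)) + 20 * (d * d))
    ≤⟨ ℕ.+-monoʳ-≤ (2 * m + 2 * (m * D₀)) step ⟩
  (2 * m + 2 * (m * D₀)) + (10 * d + 10 * (d * suc ((D₀ + d) + (D₀ + d))))
    ≡⟨ expandʳ m d D₀ ⟩
  (m + 10 * d) * (suc D₀ + suc D₀) + 20 * (d * d) ∎)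
  where
  open import Data.Nat using (_+_; _*_)
  open ℕ.≤-Reasoning
  expandˡ : ∀ m d D₀ → suc (2 * m * suc (suc D₀ + (m + 10 * d) + 2 * m * d)) + 20 * (d * d)
    ≡ (2 * m + 2 * (m * D₀)) + (1 + 2 * m + 2 * (m * m) + 20 * (d * m) + 4 * (d * (m * m)) + 20 * (d * d))
  expandˡ = solve-∀
  expandʳ : ∀ m d D₀ → (2 * m + 2 * (m * D₀)) + (10 * d + 10 * (d * suc ((D₀ + d) + (D₀ + d))))
    ≡ (m + 10 * d) * (suc D₀ + suc D₀) + 20 * (d * d)
  expandʳ = solve-∀
  collect : ∀ d x s → 10 * d + 2 * x + 2 * s + 20 * x + 4 * s + 20 * x ≡ 10 * d + (42 * x + 6 * s)
  collect = solve-∀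
  x≤dx : ∀ x → x ≤ d * x
  x≤dx x = ℕ.≤-trans (ℕ.≤-reflexive (sym (ℕ.*-identityˡ x))) (ℕ.*-monoˡ-≤ x 1≤d)
  42dm≤4dm² : 42 * (d * m) ≤ 4 * (d * (m * m))
  42dm≤4dm² = ℕ.≤-trans (ℕ.*-monoˡ-≤ (d * m) {42} {48} (ℕ.m≤m+n 42 6)) (ℕ.≤-trans (ℕ.≤-reflexive (lemma d m))
    (ℕ.*-monoʳ-≤ 4 (ℕ.*-monoʳ-≤ d (ℕ.*-monoˡ-≤ m 12≤m))))
    where
    lemma : ∀ d m → 48 * (d * m) ≡ 4 * (d * (12 * m))
    lemma = solve-∀
  step : 1 + 2 * m + 2 * (m * m) + 20 * (d * m) + 4 * (d * (m * m)) + 20 * (d * d) ≤ 10 * d + 10 *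
      (d * suc ((D₀ + d) + (D₀ + d)))
  step = begin
    1 + 2 * m + 2 * (m * m) + 20 * (d * m) + 4 * (d * (m * m)) + 20 * (d * d)
      ≤⟨ ℕ.+-mono-≤ (ℕ.+-monoˡ-≤ (4 * (d * (m * m))) (ℕ.+-monoˡ-≤ (20 * (d * m)) (ℕ.+-mono-≤ (ℕ.+-mono-≤
           (ℕ.≤-trans 1≤d (ℕ.m≤n*m d 10)) (ℕ.*-monoʳ-≤ 2 (x≤dx m))) (ℕ.*-monoʳ-≤ 2 (x≤dx (m * m))))))
           (ℕ.*-monoʳ-≤ 20 (ℕ.*-monoʳ-≤ d d≤m)) ⟩
    10 * d + 2 * (d * m) + 2 * (d * (m * m)) + 20 * (d * m) + 4 * (d * (m * m)) + 20 * (d * m)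
      ≡⟨ collect d (d * m) (d * (m * m)) ⟩
    10 * d + (42 * (d * m) + 6 * (d * (m * m)))
      ≤⟨ ℕ.+-monoʳ-≤ (10 * d) (ℕ.+-monoˡ-≤ (6 * (d * (m * m))) 42dm≤4dm²) ⟩
    10 * d + (4 * (d * (m * m)) + 6 * (d * (m * m)))
      ≡⟨ cong (λ x → 10 * d + x) (ℕ.*-distribʳ-+ (d * (m * m)) 4 6) ⟨
    10 * d + 10 * (d * (m * m))
      ≤⟨ ℕ.+-monoʳ-≤ (10 * d) (ℕ.*-monoʳ-≤ 10 (ℕ.*-monoʳ-≤ d m²≤q)) ⟩
    10 * d + 10 * (d * suc ((D₀ + d) + (D₀ + d))) ∎

-- Division by ℓ = 2m: the part m q of J q gives the main term, the other contributions are at most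
-- d q + d q + 10 d q, and q ≤ 3m² turns 12 d q / m into 36 d m.
count⇒2N≤ : ∀ m d D₀ N → 1 ≤ d → 1 ≤ m → let h = D₀ ℕ.+ d; q = suc (h ℕ.+ h) in q ≤ m ℕ.* m ℕ.+ 2 ℕ.* m →
  N ℕ.* (2 ℕ.* m) ≤ suc D₀ ℕ.+ h ℕ.* d ℕ.+ (m ℕ.+ 10 ℕ.* d) ℕ.* q → 2 ℕ.* N ≤ q ℕ.+ 36 ℕ.* (d ℕ.* m)
count⇒2N≤ m@(suc _) d D₀ N 1≤d 1≤m q≤ N≤ = ℕ.*-cancelˡ-≤ m (begin
  m * (2 * N)                                       ≡⟨ swap m N ⟩
  N * (2 * m)                                       ≤⟨ N≤ ⟩
  suc D₀ + h * d + (m + 10 * d) * q                 ≤⟨ ℕ.+-monoˡ-≤ ((m + 10 * d) * q) (ℕ.+-mono-≤ D≤dq hd≤dq) ⟩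
  d * q + d * q + (m + 10 * d) * q                  ≡⟨ collect m d q ⟩
  m * q + 12 * (d * q)                              ≤⟨ ℕ.+-monoʳ-≤ (m * q) (ℕ.*-monoʳ-≤ 12 (ℕ.*-monoʳ-≤ d q≤3m²)) ⟩
  m * q + 12 * (d * (3 * (m * m)))                  ≡⟨ factor m d q ⟩
  m * (q + 36 * (d * m))                            ∎)
  where
  open import Data.Nat using (_+_; _*_)
  open ℕ.≤-Reasoning
  h q : ℕ
  h = D₀ + d
  q = suc (h + h)
  swap : ∀ m N → m * (2 * N) ≡ N * (2 * m)
  swap = solve-∀
  collect : ∀ m d q → d * q + d * q + (m + 10 * d) * q ≡ m * q + 12 * (d * q)
  collect = solve-∀
  factor : ∀ m d q → m * q + 12 * (d * (3 * (m * m))) ≡ m * (q + 36 * (d * m))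
  factor = solve-∀
  h≤q : h ≤ q
  h≤q = ℕ.m≤n⇒m≤1+n (ℕ.m≤m+n h h)
  D≤dq : suc D₀ ≤ d * q
  D≤dq = ℕ.≤-trans (s≤s (ℕ.≤-trans (ℕ.m≤m+n D₀ d) (ℕ.m≤m+n h h)))
      (ℕ.≤-trans (ℕ.≤-reflexive (sym (ℕ.*-identityˡ q))) (ℕ.*-monoˡ-≤ q 1≤d))
  hd≤dq : h * d ≤ d * q
  hd≤dq = ℕ.≤-trans (ℕ.≤-reflexive (ℕ.*-comm h d)) (ℕ.*-monoʳ-≤ d h≤q)
  q≤3m² : q ≤ 3 * (m * m)
  q≤3m² = ℕ.≤-trans q≤ (ℕ.≤-trans (ℕ.+-monoʳ-≤ (m * m) (ℕ.*-monoʳ-≤ 2 (ℕ.m≤n*m m m))) (ℕ.≤-reflexive (triple (m * m))))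
    where
    triple : ∀ s → s + 2 * s ≡ 3 * s
    triple = solve-∀

-- The bound for character sums of products

module CharacterSumBound {h : ℕ} (F : FieldOn (suc (h ℕ.+ h))) (0<h : 0 < h)
  (m : ℕ) (12≤m : 12 ≤ m) (m²≤q : m ℕ.* m ≤ suc (h ℕ.+ h)) (q≤m²+2m : suc (h ℕ.+ h) ≤ m ℕ.* m ℕ.+ 2 ℕ.* m) where
  open FieldOn F using (0#; 1#; -_; 0≢1)
  open FieldAlgebra F using (_^_)
  open Products F
  open OddField F 0<h
  open CharacterSums F 0<h
  open SumsOverLists

  2m≤h+h : 2 ℕ.* m ≤ h ℕ.+ h
  2m≤h+h = ℕ.s≤s⁻¹ (ℕ.≤-trans (ℕ.≤-trans 2m<12m (ℕ.*-monoˡ-≤ m 12≤m)) m²≤q)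
    where
    2m<12m : 2 ℕ.* m < 12 ℕ.* m
    2m<12m = ℕ.*-monoˡ-< m {{ℕ.>-nonZero (ℕ.≤-trans (s≤s z≤n) 12≤m)}} {2} {12} (s≤s (s≤s (s≤s z≤n)))

  m≤h : m ≤ h
  m≤h = ℕ.*-cancelˡ-≤ 2 (ℕ.≤-trans 2m≤h+h (ℕ.≤-reflexive (cong (h ℕ.+_) (sym (ℕ.+-identityʳ h)))))

  2*fibre≤ : ∀ y S ε → ε ≢ 0# → Unique (y ∷ S) → length (y ∷ S) ≤ m → 2 ℕ.* length (fibre (y ∷ S) ε) ≤ q ℕ.+ 36 ℕ.*
      (length (y ∷ S) ℕ.* m)
  2*fibre≤ y S ε ε≢0 u d≤m with c , φ[c]≢0 ← φ-nonzero (y ∷ S) (ℕ.≤-<-trans (ℕ.≤-trans d≤m m≤h) (s≤s (ℕ.m≤m+n h h))) =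
    -- The arithmetic lemmas write h as D₀ + d, which keeps truncated subtraction out of them; the
    -- transports translate back.
    subst (λ h′ → 2 ℕ.* N ≤ suc (h′ ℕ.+ h′) ℕ.+ 36 ℕ.* (d ℕ.* m)) D₀+d≡h
      (count⇒2N≤ m d D₀ N (s≤s z≤n) (ℕ.≤-trans (s≤s z≤n) 12≤m)
        (subst (λ h′ → suc (h′ ℕ.+ h′) ≤ m ℕ.* m ℕ.+ 2 ℕ.* m) (sym D₀+d≡h) q≤m²+2m)
        (subst (λ h′ → N ℕ.* (2 ℕ.* m) ≤ suc D₀ ℕ.+ h′ ℕ.* d ℕ.+ (m ℕ.+ 10 ℕ.* d) ℕ.* suc (h′ ℕ.+ h′)) (sym D₀+d≡h)
          (Stepanov.Count.count F 0<h y S u c φ[c]≢0 D≤ (m ℕ.+ 10 ℕ.* d) (2 ℕ.* m) (ℕ.≤-trans 2m≤h+h (ℕ.n≤1+n _)) ε ε≢0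
            (constraints<unknowns m d D₀ (s≤s z≤n) d≤m 12≤m (subst (λ h′ → m ℕ.* m ≤ suc (h′ ℕ.+ h′)) (sym D₀+d≡h) m²≤q))
            (fibre (y ∷ S) ε) (Unique.filter⁺ (λ x → φ (y ∷ S) x ^ h Fin.≟ ε) (Unique.allFin⁺ q))
                (All.all-filter (λ x → φ (y ∷ S) x ^ h Fin.≟ ε) elements))))
    where
    d D₀ N : ℕ
    d = length (y ∷ S)
    D₀ = h ∸ d
    N = length (fibre (y ∷ S) ε)
    D₀+d≡h : D₀ ℕ.+ d ≡ h
    D₀+d≡h = ℕ.m∸n+n≡m (ℕ.≤-trans d≤m m≤h)
    D≤ : D₀ ℕ.+ D₀ ℕ.+ d ≤ h ℕ.+ h
    D≤ = ℕ.≤-trans (ℕ.≤-reflexive (ℕ.+-assoc D₀ D₀ d)) (ℕ.≤-trans (ℕ.≤-reflexive (cong (D₀ ℕ.+_) D₀+d≡h))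
        (ℕ.+-monoˡ-≤ h (ℕ.m∸n≤m h d)))

  -- The zeros of f number at most d ≤ d m and raise 36 to 37. Using n in place of d makes the bound
  -- uniform over all nonempty subsets of Y.
  characterSum-bound : ∀ n → n ≤ m → ∀ y S → Unique (y ∷ S) → length (y ∷ S) ≤ n → ∣ sum (λ x → χ (φ (y ∷ S) x)) elements ∣ ≤
      37 ℕ.* (n ℕ.* m)
  characterSum-bound n n≤m y S u d≤n = ∣i∣≤ {sum (λ x → χ (φ (y ∷ S) x)) elements} {length elements} (sum-χ (y ∷ S))
      (sum-χ⁻ (y ∷ S)) (total 1# (0≢1 ∘ sym)) (total (- 1#) -1≢0)
    where
    open ℕ.≤-Reasoning
    d : ℕ
    d = length (y ∷ S)
    add : ∀ a x → a ℕ.+ 36 ℕ.* x ℕ.+ x ≡ a ℕ.+ 37 ℕ.* x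
    add = solve-∀
    d≤dm : d ≤ d ℕ.* m
    d≤dm = ℕ.m≤m*n d m {{ℕ.>-nonZero (ℕ.≤-trans (s≤s z≤n) 12≤m)}}
    total : ∀ ε → ε ≢ 0# → 2 ℕ.* length (fibre (y ∷ S) ε) ℕ.+ length (zeros (y ∷ S)) ≤ length elements ℕ.+ 37 ℕ.* (n ℕ.* m)
    total ε ε≢0 = begin
      2 ℕ.* length (fibre (y ∷ S) ε) ℕ.+ length (zeros (y ∷ S))  ≤⟨ ℕ.+-mono-≤ (2*fibre≤ y S ε ε≢0 u (ℕ.≤-trans d≤n n≤m))
          (ℕ.≤-trans (length-zeros (y ∷ S)) d≤dm) ⟩
      q ℕ.+ 36 ℕ.* (d ℕ.* m) ℕ.+ d ℕ.* m                         ≡⟨ add q (d ℕ.* m) ⟩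
      q ℕ.+ 37 ℕ.* (d ℕ.* m)                                     ≤⟨ ℕ.+-monoʳ-≤ q (ℕ.*-monoʳ-≤ 37 (ℕ.*-monoˡ-≤ m d≤n)) ⟩
      q ℕ.+ 37 ℕ.* (n ℕ.* m)                                     ≡⟨ cong (ℕ._+ 37 ℕ.* (n ℕ.* m)) length-elements ⟨
      length elements ℕ.+ 37 ℕ.* (n ℕ.* m)                       ∎

open import Data.Nat using (_*_; _^_)

-- Elementary number theory and the threshold for q

module Asymptotics where
  open import Data.Nat using (_+_)

  even∨odd : ∀ n → ∃[ j ] (n ≡ j + j ⊎ n ≡ suc (j + j))
  even∨odd zero    = 0 , inj₁ refl
  even∨odd (suc n) with even∨odd n
  ... | j , inj₁ e = j , inj₂ (cong suc e)
  ... | j , inj₂ e = suc j , inj₁ (cong suc (trans e (sym (ℕ.+-suc j j))))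

  oddPrime⇒odd : ∀ {p} → Prime p → p ≢ 2 → ∃[ j ] (p ≡ suc (j + j))
  oddPrime⇒odd {p} p-prime p≢2 with even∨odd p
  ... | j , inj₂ e = j , e
  ... | j , inj₁ e with prime⇒irreducible p-prime {2} (divides j (trans e (lemma j)))
    where
    lemma : ∀ j → j + j ≡ j * 2
    lemma = solve-∀
  ...   | inj₁ ()
  ...   | inj₂ 2≡p = ⊥-elim (p≢2 (sym 2≡p))

  odd-^ : ∀ j k → ∃[ i ] (suc (j + j) ^ k ≡ suc (i + i))
  odd-^ j zero    = 0 , refl
  odd-^ j (suc k) with i , e ← odd-^ j k = 2 * (i * j) + i + j , trans (cong (suc (j + j) *_) e) (lemma i j)
    where
    lemma : ∀ i j → suc (j + j) * suc (i + i) ≡ suc ((2 * (i * j) + i + j) + (2 * (i * j) + i + j))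
    lemma = solve-∀

  oddPrimePower⇒odd : ∀ {q} → OddPrimePower q → ∃[ h ] (q ≡ suc (h + h))
  oddPrimePower⇒odd (p , k , p-prime , p≢2 , refl) with j , refl ← oddPrime⇒odd p-prime p≢2 = odd-^ j (suc k)

  √ : ∀ q → ∃[ m ] (m * m ≤ q × q ≤ m * m + 2 * m)
  √ zero    = 0 , z≤n , z≤n
  √ (suc q) with m , m²≤q , q≤ ← √ q with suc q ℕ.≤? m * m + 2 * m
  ... | yes 1+q≤ = m , ℕ.m≤n⇒m≤1+n m²≤q , 1+q≤
  ... | no  1+q≰ = suc m , ℕ.≤-trans (ℕ.≤-reflexive (lemma m)) (ℕ.≰⇒> 1+q≰) ,
                   ℕ.≤-trans (s≤s q≤) (ℕ.≤-trans (ℕ.≤-reflexive (sym (lemma m))) (ℕ.m≤m+n _ _))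
    where
    lemma : ∀ m → suc m * suc m ≡ suc (m * m + 2 * m)
    lemma = solve-∀

  ^-cancelʳ-≤ : ∀ b {x y} .{{_ : NonZero b}} → x ^ b ≤ y ^ b → x ≤ y
  ^-cancelʳ-≤ b {x} {y} e with x ℕ.≤? y
  ... | yes ok = ok
  ... | no ¬ok = ⊥-elim (ℕ.<⇒≱ (ℕ.^-monoˡ-< b (ℕ.≰⇒> ¬ok)) e)

  *-square-cancel-≤ : ∀ {x y} → x * x ≤ y * y → x ≤ y
  *-square-cancel-≤ {x} {y} e with x ℕ.≤? y
  ... | yes ok = ok
  ... | no ¬ok = ⊥-elim (ℕ.<⇒≱ (ℕ.*-mono-< (ℕ.≰⇒> ¬ok) (ℕ.≰⇒> ¬ok)) e)

  n≤2^n : ∀ n → n ≤ 2 ^ n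
  n≤2^n zero    = z≤n
  n≤2^n (suc n) = ℕ.+-mono-≤ (ℕ.m^n>0 2 n) (ℕ.≤-trans (n≤2^n n) (ℕ.m≤m+n _ 0))

  -- The inductive step uses (t + 2)² ≤ 2(t + 1)², which needs t ≥ 2; hence three base cases.
  [1+t]²≤4*2^t : ∀ t → suc t * suc t ≤ 4 * 2 ^ t
  [1+t]²≤4*2^t 0 = s≤s z≤n
  [1+t]²≤4*2^t 1 = ℕ.m≤m+n 4 4
  [1+t]²≤4*2^t 2 = ℕ.m≤m+n 9 7
  [1+t]²≤4*2^t (suc t@(suc (suc u))) = begin
    suc (suc t) * suc (suc t)         ≤⟨ ℕ.m≤m+n _ (u * u + 4 * u + 2) ⟩
    suc (suc t) * suc (suc t) + (u * u + 4 * u + 2) ≡⟨ lemma u ⟩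
    2 * (suc t * suc t)               ≤⟨ ℕ.*-monoʳ-≤ 2 ([1+t]²≤4*2^t t) ⟩
    2 * (4 * 2 ^ t)                   ≡⟨ lemma′ (2 ^ t) ⟩
    4 * 2 ^ suc t                     ∎
    where
    open ℕ.≤-Reasoning
    lemma : ∀ u → suc (suc (suc (suc u))) * suc (suc (suc (suc u))) + (u * u + 4 * u + 2) ≡ 2 *
        (suc (suc (suc u)) * suc (suc (suc u)))
    lemma = solve-∀
    lemma′ : ∀ x → 2 * (4 * x) ≡ 4 * (2 * x)
    lemma′ = solve-∀

  -- With t = ⌊n/b⌋, taking b-th roots leaves 2^t ≤ 38(t + 1)b. Since 2^t is at least (t + 1)²/4,
  -- this forces t + 1 ≤ 4 · 38 b.
  2^n≤[38n]^b⇒n≤ : ∀ n b .{{_ : NonZero b}} → 2 ^ n ≤ (38 * n) ^ b → n ≤ 152 * b * b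
  2^n≤[38n]^b⇒n≤ n b e = ℕ.≤-trans n≤[1+t]b (ℕ.*-monoˡ-≤ b 1+t≤152b)
    where
    open ℕ.≤-Reasoning
    t : ℕ
    t = n / b
    n≤[1+t]b : n ≤ suc t * b
    n≤[1+t]b = ℕ.≤-trans (ℕ.≤-reflexive (m≡m%n+[m/n]*n n b)) (ℕ.+-monoˡ-≤ (t * b) (ℕ.<⇒≤ (m%n<n n b)))
    tb≤n : t * b ≤ n
    tb≤n = ℕ.≤-trans (ℕ.m≤n+m (t * b) (n % b)) (ℕ.≤-reflexive (sym (m≡m%n+[m/n]*n n b)))
    2^t≤ : 2 ^ t ≤ 38 * (suc t * b)
    2^t≤ = ^-cancelʳ-≤ b (begin
      (2 ^ t) ^ b              ≡⟨ ℕ.^-*-assoc 2 t b ⟩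
      2 ^ (t * b)              ≤⟨ ℕ.^-monoʳ-≤ 2 tb≤n ⟩
      2 ^ n                    ≤⟨ e ⟩
      (38 * n) ^ b             ≤⟨ ℕ.^-monoˡ-≤ b (ℕ.*-monoʳ-≤ 38 n≤[1+t]b) ⟩
      (38 * (suc t * b)) ^ b   ∎)
    1+t≤152b : suc t ≤ 152 * b
    1+t≤152b = ℕ.*-cancelˡ-≤ (suc t) (begin
      suc t * suc t            ≤⟨ [1+t]²≤4*2^t t ⟩
      4 * 2 ^ t                ≤⟨ ℕ.*-monoʳ-≤ 4 2^t≤ ⟩
      4 * (38 * (suc t * b))   ≡⟨ lemma (suc t) b ⟩
      suc t * (152 * b)        ∎)
      where
      lemma : ∀ s b → 4 * (38 * (s * b)) ≡ s * (152 * b)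
      lemma = solve-∀

  -- 144 = 12² gives m ≥ 12. The power is (38 n)^(2b) at n = 152 b², the largest n still possible if
  -- the error were not below q.
  threshold : ℕ → ℕ
  threshold b = 144 + suc ((38 * (152 * b * b)) ^ (2 * b))

  module _ (a b q n m : ℕ) (0<a : 0 < a) (0<b : 0 < b) (large : threshold b ≤ q)
    (m²≤q : m * m ≤ q) (q≤m²+2m : q ≤ m * m + 2 * m) (small : 2 ^ (2 * b * n) ≤ q ^ (b ∸ 2 * a)) where

    private instance
      b≢0 : NonZero b
      b≢0 = ℕ.>-nonZero 0<b

    144≤q : 144 ≤ q
    144≤q = ℕ.≤-trans (ℕ.m≤m+n 144 _) large

    private instance
      q≢0 : NonZero q
      q≢0 = ℕ.>-nonZero (ℕ.≤-trans (s≤s z≤n) 144≤q)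

    12≤m : 12 ≤ m
    12≤m with 12 ℕ.≤? m
    ... | yes ok = ok
    ... | no ¬ok = ⊥-elim (ℕ.<⇒≱ (s≤s (ℕ.≤-trans q≤m²+2m (ℕ.+-mono-≤ (ℕ.*-mono-≤ m≤11 m≤11) (ℕ.*-monoʳ-≤ 2 m≤11)))) 144≤q)
      where
      m≤11 : m ≤ 11
      m≤11 = ℕ.s≤s⁻¹ (ℕ.≰⇒> ¬ok)

    private
      instance
        m≢0 : NonZero m
        m≢0 = ℕ.>-nonZero (ℕ.≤-trans (s≤s z≤n) 12≤m)

      open ℕ.≤-Reasoning

      [4^n]^b : (2 ^ n * 2 ^ n) ^ b ≡ 2 ^ (2 * b * n)
      [4^n]^b = trans (cong (_^ b) (sym (ℕ.^-distribˡ-+-* 2 n n)))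
          (trans (ℕ.^-*-assoc 2 (n + n) b) (cong (2 ^_) (lemma n b)))
        where
        lemma : ∀ n b → (n + n) * b ≡ 2 * b * n
        lemma = solve-∀

      -- Since a > 0, the hypothesis leaves at least one factor q to spare; this factor absorbs the
      -- loss polynomial in n.
      1+c≤b : suc (b ∸ 2 * a) ≤ b
      1+c≤b = x∸y<x 0<b (ℕ.≤-trans 0<a (ℕ.m≤m+n a _))
        where
        x∸y<x : ∀ {x y} → 0 < x → 0 < y → suc (x ∸ y) ≤ x
        x∸y<x {suc x} {suc y} _ _ = s≤s (ℕ.m∸n≤m x y)

      small′ : (2 ^ n * 2 ^ n) ^ b * q ≤ q ^ b
      small′ = begin
        (2 ^ n * 2 ^ n) ^ b * q     ≡⟨ cong (_* q) [4^n]^b ⟩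
        2 ^ (2 * b * n) * q         ≤⟨ ℕ.*-monoˡ-≤ q small ⟩
        q ^ (b ∸ 2 * a) * q         ≡⟨ ℕ.*-comm _ q ⟩
        q ^ suc (b ∸ 2 * a)         ≤⟨ ℕ.^-monoʳ-≤ q 1+c≤b ⟩
        q ^ b                       ∎

      4^n≤q : 2 ^ n * 2 ^ n ≤ q
      4^n≤q = ^-cancelʳ-≤ b (ℕ.≤-trans (ℕ.m≤m*n _ q) small′)

    n≤m : n ≤ m
    n≤m = ℕ.≤-trans (n≤2^n n) (ℕ.s≤s⁻¹ 2^n<1+m)
      where
      lemma : ∀ m → suc (m * m + 2 * m) ≡ suc m * suc m
      lemma = solve-∀
      2^n<1+m : 2 ^ n < suc m
      2^n<1+m with 2 ^ n ℕ.<? suc m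
      ... | yes ok = ok
      ... | no ¬ok = ⊥-elim (ℕ.<⇒≱ (s≤s (ℕ.≤-trans 4^n≤q q≤m²+2m))
          (ℕ.≤-trans (ℕ.≤-reflexive (lemma m)) (ℕ.*-mono-≤ (ℕ.≮⇒≥ ¬ok) (ℕ.≮⇒≥ ¬ok))))

    -- Otherwise q ≤ 2^n · 38n · m; squaring and cancelling m² ≤ q gives q ≤ 4^n (38n)². Its b-th
    -- power, compared with 4^(nb) q ≤ q^b, yields q ≤ (38n)^(2b). Together with 4^n ≤ q this bounds
    -- n in terms of b alone, and then q, against the threshold.
    error<q : n * 2 ^ n + 2 ^ n * (37 * (n * m)) < q
    error<q with n * 2 ^ n + 2 ^ n * (37 * (n * m)) ℕ.<? q
    ... | yes ok = ok
    ... | no ¬ok = ⊥-elim (ℕ.<⇒≱ (ℕ.≤-trans (ℕ.m≤n+m _ 144) large) (begin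
      q                                          ≤⟨ q≤[38n]^2b ⟩
      ((38 * n) * (38 * n)) ^ b                  ≤⟨ ℕ.^-monoˡ-≤ b (ℕ.*-mono-≤ 38n≤ 38n≤) ⟩
      ((38 * N) * (38 * N)) ^ b                  ≡⟨ cong (_^ b) (cong (38 * N *_) (sym (ℕ.*-identityʳ (38 * N)))) ⟩
      ((38 * N) ^ 2) ^ b                         ≡⟨ ℕ.^-*-assoc (38 * N) 2 b ⟩
      (38 * N) ^ (2 * b)                         ∎))
      where
      N : ℕ
      N = 152 * b * b
      q≤ : q ≤ 2 ^ n * (38 * n) * m
      q≤ = begin
        q                                                ≤⟨ ℕ.≮⇒≥ ¬ok ⟩
        n * 2 ^ n + 2 ^ n * (37 * (n * m))               ≤⟨ ℕ.+-monoˡ-≤ _ (ℕ.m≤m*n (n * 2 ^ n) m) ⟩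
        n * 2 ^ n * m + 2 ^ n * (37 * (n * m))           ≡⟨ lemma n (2 ^ n) m ⟩
        2 ^ n * (38 * n) * m                             ∎
        where
        lemma : ∀ n x m → n * x * m + x * (37 * (n * m)) ≡ x * (38 * n) * m
        lemma = solve-∀
      q≤4^n : q ≤ (2 ^ n * 2 ^ n) * ((38 * n) * (38 * n))
      q≤4^n = ℕ.*-cancelʳ-≤ _ _ q (begin
        q * q                                                       ≤⟨ ℕ.*-mono-≤ q≤ q≤ ⟩
        (2 ^ n * (38 * n) * m) * (2 ^ n * (38 * n) * m)             ≡⟨ lemma (2 ^ n) (38 * n) m ⟩
        (2 ^ n * 2 ^ n) * ((38 * n) * (38 * n)) * (m * m)           ≤⟨ ℕ.*-monoʳ-≤ ((2 ^ n * 2 ^ n) * ((38 * n) * (38 * n)))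
            m²≤q ⟩
        (2 ^ n * 2 ^ n) * ((38 * n) * (38 * n)) * q                 ∎)
        where
        lemma : ∀ x y m → (x * y * m) * (x * y * m) ≡ (x * x) * (y * y) * (m * m)
        lemma = solve-∀
      ^-distribʳ : ∀ x y b → (x * y) ^ b ≡ x ^ b * y ^ b
      ^-distribʳ x y zero    = refl
      ^-distribʳ x y (suc b) = trans (cong (x * y *_) (^-distribʳ x y b)) (lemma x y (x ^ b) (y ^ b))
        where
        lemma : ∀ x y u v → x * y * (u * v) ≡ x * u * (y * v)
        lemma = solve-∀
      q≤[38n]^2b : q ≤ ((38 * n) * (38 * n)) ^ b
      q≤[38n]^2b = ℕ.*-cancelˡ-≤ ((2 ^ n * 2 ^ n) ^ b) {{ℕ.m^n≢0 (2 ^ n * 2 ^ n) b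
          {{ℕ.m*n≢0 (2 ^ n) (2 ^ n) {{ℕ.m^n≢0 2 n}} {{ℕ.m^n≢0 2 n}}}}}} (begin
        (2 ^ n * 2 ^ n) ^ b * q                                ≤⟨ small′ ⟩
        q ^ b                                                  ≤⟨ ℕ.^-monoˡ-≤ b q≤4^n ⟩
        ((2 ^ n * 2 ^ n) * ((38 * n) * (38 * n))) ^ b          ≡⟨ ^-distribʳ (2 ^ n * 2 ^ n) _ b ⟩
        (2 ^ n * 2 ^ n) ^ b * ((38 * n) * (38 * n)) ^ b        ∎)
      2^n≤ : 2 ^ n ≤ (38 * n) ^ b
      2^n≤ = *-square-cancel-≤ (ℕ.≤-trans 4^n≤q (ℕ.≤-trans q≤[38n]^2b (ℕ.≤-reflexive (^-distribʳ (38 * n) (38 * n) b))))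
      38n≤ : 38 * n ≤ 38 * N
      38n≤ = ℕ.*-monoʳ-≤ 38 (2^n≤[38n]^b⇒n≤ n b 2^n≤)

open Asymptotics

-- From sign patterns to shattering

module Shattering {h : ℕ} (F : FieldOn (suc (h ℕ.+ h))) (0<h : 0 < h) where
  open FieldOn F using (_+_; -_) renaming (_*_ to _·_)
  open FieldAlgebra F renaming (_^_ to _^ᶠ_)
  open Products F
  open OddField F 0<h
  open CharacterSums F 0<h
  open CommutativeRing fieldRing using (zeroˡ)
  open FSolver

  realises⇒shatters : ∀ {n} (Y : Vec (Fin q) n) →
    (∀ (A : Fin n → Bool) → ∃[ x ] Realises (tabulate (λ j → lookup Y j , A j)) x) → Shatters F Y
  realises⇒shatters Y realise A with x , r ← realise A = x , (λ j → y≢x (A j) (at j)) , λ j → mk⇔ (to (at j)) (from (at j))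
    where
    at : ∀ j → χ (lookup Y j + - x) ≡ signed (A j)
    at = All.tabulate⁻ r
    -- The condition that x lies outside Y comes for free: χ(0) = 0 is not a sign.
    y≢x : ∀ {y} b → χ (y + - x) ≡ signed b → y ≢ x
    y≢x true  e y≡x with () ← trans (sym (χ≡0 (≡⇒-≡0 y≡x))) e
    y≢x false e y≡x with () ← trans (sym (χ≡0 (≡⇒-≡0 y≡x))) e
    to : ∀ {y b} → χ (y + - x) ≡ signed b → b ≡ true → InShiftedSquares F x y
    to {y} e refl with sign (y + - x)
    ... | inj₁ e′ with () ← trans (sym (χ≡0 e′)) e
    ... | inj₂ (inj₂ e′) with () ← trans (sym (χ≡-1 e′)) e
    ... | inj₂ (inj₁ e′) with t , tt≡ ← ^h≡1⇒square (y + - x) e′ =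
      t · t , (t , (λ t≡0 → y≢x true e (-≡0 (trans (sym tt≡) (trans (cong (_· t) t≡0) (zeroˡ t))))) , refl) ,
      trans (solve 2 (λ y x → y := (y :+ :- x) :+ x) refl y x) (cong (_+ x) (sym tt≡))
    from : ∀ {y b} → χ (y + - x) ≡ signed b → InShiftedSquares F x y → b ≡ true
    from {b = true}  e _ = refl
    from {b = false} e (_ , (t , t≢0 , refl) , refl)
      with () ← trans (sym (χ≡1 (trans (cong (_^ᶠ h) (solve 2 (λ z x → (z :+ x) :+ :- x := z) refl (t · t) x))
          (square-^h t t≢0)))) e

  large⇒shatters : ∀ {a b} → 0 < a → 0 < b → threshold b ≤ q → ∀ n (Y : Vec (Fin q) n) → Distinct Y →
    2 ℕ.^ (2 ℕ.* b ℕ.* n) ≤ q ℕ.^ (b ∸ 2 ℕ.* a) → Shatters F Y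
  large⇒shatters {a} {b} 0<a 0<b large n Y distinct small with m , m²≤q , q≤m²+2m ← √ q =
    realises⇒shatters Y λ A → let pattern-of = λ j → lookup Y j , A j in
      realised n (37 ℕ.* (n ℕ.* m))
        (CharacterSumBound.characterSum-bound F 0<h m (12≤m a b q n m 0<a 0<b large m²≤q q≤m²+2m small) m²≤q q≤m²+2m
          n (n≤m a b q n m 0<a 0<b large m²≤q q≤m²+2m small))
        (tabulate pattern-of)
        (subst Unique (sym (List.map-tabulate pattern-of proj₁)) (Unique.tabulate⁺ (λ {i} {j} → distinct i j)))
        (ℕ.≤-reflexive (List.length-tabulate pattern-of))
        (subst (λ k → k ℕ.* 2 ℕ.^ k ℕ.+ 2 ℕ.^ k ℕ.* (37 ℕ.* (n ℕ.* m)) < q) (sym (List.length-tabulate pattern-of))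
          (error<q a b q n m 0<a 0<b large m²≤q q≤m²+2m small))

-- Here ε = a/b. Multiplying n ≤ (1/2 - a/b) log₂ q by 2b and exponentiating gives the last
-- hypothesis; rational ε suffice because the claim for a smaller ε implies it for a larger one. If
-- 2a ≥ b, the exponent is 0 and only the empty Y remains.
theorem1p3 : (a b : ℕ) → 0 < a → 0 < b →
    ∃[ q₀ ] ((q : ℕ) → (F : FieldOn q) → OddPrimePower q → q₀ ≤ q →
    (n : ℕ) → (Y : Vec (Fin q) n) → Distinct Y →
    2 ^ (2 * b * n) ≤ q ^ (b ∸ 2 * a) →
    Shatters F Y)
theorem1p3 a b 0<a 0<b = threshold b , shatters
  where
  0<h : ∀ h → threshold b ≤ suc (h ℕ.+ h) → 0 < h
  0<h zero    (s≤s ())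
  0<h (suc h) _ = s≤s z≤n
  shatters : ∀ q (F : FieldOn q) → OddPrimePower q → threshold b ≤ q → ∀ n (Y : Vec (Fin q) n) → Distinct Y →
    2 ^ (2 * b * n) ≤ q ^ (b ∸ 2 * a) → Shatters F Y
  shatters q F odd large with h , refl ← oddPrimePower⇒odd odd = Shattering.large⇒shatters {h} F (0<h h large) 0<a 0<b large
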